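{- For every integer $n\ge 0$ and every $\tau\in\{213,132,321\}$, $$\sum_{\sigma\in S_n(\tau)}q^{\mathrm{exc}(\sigma)}p^{\mathrm{crs}(\sigma)}=C_n(q,p).$$
   Context: $S_n(\tau)$: permutations of $[n]$ avoiding the pattern $\tau$ ($S_0(\tau)$ contains only the empty permutation). $\mathrm{exc}(\sigma)=|\{i:\sigma(i)>i\}|$; a crossing is a pair $(i,j)$ with $i<j<\sigma(i)<\sigma(j)$ or $\sigma(i)<\sigma(j)\le i<j$, and $\mathrm{crs}(\sigma)$ is their number. The $q,p$-Catalan numbers are defined by $C_0(q,p)=C_1(q,p)=1$ and, for $n\ge2$, $C_n(q,p)=C_{n-1}(q,p)+q\sum_{k=0}^{n-2}p^kC_k(q,p)C_{n-1-k}(q,p)$. -}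

module Defs where

open import Data.Nat as ℕ using (ℕ; zero; suc; _∸_)
import Data.Nat.Properties as ℕP
open import Data.Fin as Fin using (Fin; toℕ)
open import Data.Fin.Properties using (all?; any?; _≟_)
open import Data.Vec using (Vec; []; _∷_; lookup)
open import Data.List using (List; []; _∷_; [_]; map; concatMap; filter; length; allFin; upTo; foldr; cartesianProduct)
open import Data.Product using (_×_; _,_; Σ; ∃; proj₁; proj₂)
open import Data.Sum using (_⊎_)
open import Relation.Binary.PropositionalEquality using (_≡_)
open import Relation.Nullary using (Dec; ¬_)
open import Relation.Nullary.Decidable using (_×-dec_; _⊎-dec_; _→-dec_; ¬?)
open import Algebra.Bundles using (CommutativeSemiring)
open import Level using (Level)

-- Permutations of [n], written 0-indexed in one-line notation:
-- σ : Vec (Fin n) n with σ(i) = lookup σ i.  (Shifting [n] = {1..n} to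
-- {0..n-1} does not change exc, crs, or pattern containment.)

allWords : (k n : ℕ) → List (Vec (Fin n) k)
allWords zero    n = [ [] ]
allWords (suc k) n = concatMap (λ w → map (λ a → a ∷ w) (allFin n)) (allWords k n)

IsPerm : ∀ {n} → Vec (Fin n) n → Set
IsPerm {n} σ = (i j : Fin n) → lookup σ i ≡ lookup σ j → i ≡ j

isPerm? : ∀ {n} (σ : Vec (Fin n) n) → Dec (IsPerm σ)
isPerm? σ = all? (λ i → all? (λ j → (lookup σ i ≟ lookup σ j) →-dec (i ≟ j)))

perms : (n : ℕ) → List (Vec (Fin n) n)
perms n = filter isPerm? (allWords n n)

pat213 pat132 pat321 : Vec ℕ 3
pat213 = 2 ∷ 1 ∷ 3 ∷ []
pat132 = 1 ∷ 3 ∷ 2 ∷ []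
pat321 = 3 ∷ 2 ∷ 1 ∷ []

SameOrder : ℕ → ℕ → ℕ → ℕ → Set
SameOrder a b x y = (a ℕ.< b → x ℕ.< y) × (b ℕ.< a → y ℕ.< x)

sameOrder? : ∀ a b x y → Dec (SameOrder a b x y)
sameOrder? a b x y = (a ℕ.<? b →-dec x ℕ.<? y) ×-dec (b ℕ.<? a →-dec y ℕ.<? x)

Occurrence : ∀ {n} → Vec ℕ 3 → Vec (Fin n) n → Fin n → Fin n → Fin n → Set
Occurrence (a ∷ b ∷ c ∷ []) σ i j k =
  (i Fin.< j) × (j Fin.< k) ×
  SameOrder a b (toℕ (lookup σ i)) (toℕ (lookup σ j)) ×
  SameOrder a c (toℕ (lookup σ i)) (toℕ (lookup σ k)) ×
  SameOrder b c (toℕ (lookup σ j)) (toℕ (lookup σ k))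

occurrence? : ∀ {n} τ (σ : Vec (Fin n) n) i j k → Dec (Occurrence τ σ i j k)
occurrence? (a ∷ b ∷ c ∷ []) σ i j k =
  (i Fin.<? j) ×-dec (j Fin.<? k) ×-dec
  sameOrder? a b _ _ ×-dec sameOrder? a c _ _ ×-dec sameOrder? b c _ _

Contains : ∀ {n} → Vec ℕ 3 → Vec (Fin n) n → Set
Contains {n} τ σ = ∃ λ i → ∃ λ j → ∃ λ k → Occurrence τ σ i j k

contains? : ∀ {n} τ (σ : Vec (Fin n) n) → Dec (Contains τ σ)
contains? τ σ = any? (λ i → any? (λ j → any? (λ k → occurrence? τ σ i j k)))

Avoids : ∀ {n} → Vec ℕ 3 → Vec (Fin n) n → Set
Avoids τ σ = ¬ Contains τ σ

avoids? : ∀ {n} τ (σ : Vec (Fin n) n) → Dec (Avoids τ σ)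
avoids? τ σ = ¬? (contains? τ σ)

avoiders : (n : ℕ) → Vec ℕ 3 → List (Vec (Fin n) n)
avoiders n τ = filter (avoids? τ) (perms n)

exc : ∀ {n} → Vec (Fin n) n → ℕ
exc {n} σ = length (filter (λ i → i Fin.<? lookup σ i) (allFin n))

Crossing : ∀ {n} → Vec (Fin n) n → Fin n × Fin n → Set
Crossing σ (i , j) =
  (i Fin.< j × j Fin.< lookup σ i × lookup σ i Fin.< lookup σ j)
  ⊎ (lookup σ i Fin.< lookup σ j × lookup σ j Fin.≤ i × i Fin.< j)

crossing? : ∀ {n} (σ : Vec (Fin n) n) ij → Dec (Crossing σ ij)
crossing? σ (i , j) =
  ((i Fin.<? j) ×-dec (j Fin.<? lookup σ i) ×-dec (lookup σ i Fin.<? lookup σ j))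
  ⊎-dec ((lookup σ i Fin.<? lookup σ j) ×-dec (lookup σ j Fin.≤? i) ×-dec (i Fin.<? j))

crs : ∀ {n} → Vec (Fin n) n → ℕ
crs {n} σ = length (filter (crossing? σ) (cartesianProduct (allFin n) (allFin n)))

-- Evaluation in an arbitrary commutative semiring R (q, p ∈ R).
-- A polynomial identity in ℕ[q,p] is the same as the identity holding for
-- all q, p in all commutative semirings (ℕ[q,p] is the free one).

module _ {c ℓ : Level} (R : CommutativeSemiring c ℓ) where
  open CommutativeSemiring R
  open import Algebra.Definitions.RawSemiring rawSemiring using (_^_)

  sumR : List Carrier → Carrier
  sumR = foldr _+_ 0#

  excCrsGF : (n : ℕ) → Vec ℕ 3 → Carrier → Carrier → Carrier
  excCrsGF n τ q p = sumR (map (λ σ → q ^ exc σ * p ^ crs σ) (avoiders n τ))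

  -- q,p-Catalan numbers with a fuel argument f (needed only for termination):
  -- for f ≥ m, catF f m = C_m(q,p), where
  -- C_0 = C_1 = 1,  C_{m+2} = C_{m+1} + q Σ_{k=0}^{m} p^k C_k C_{m+1-k}.
  catF : Carrier → Carrier → ℕ → ℕ → Carrier
  catF q p zero    m                   = 1#
  catF q p (suc f) zero                = 1#
  catF q p (suc f) (suc zero)          = 1#
  catF q p (suc f) (suc (suc m))       =
    catF q p f (suc m) +
    q * sumR (map (λ k → p ^ k * catF q p f k * catF q p f (suc m ∸ k)) (upTo (suc m)))

  qpCatalan : ℕ → Carrier → Carrier → Carrier
  qpCatalan n q p = catF q p n n

{-# OPTIONS --safe #-}
module Submission where

-- Delete from a nonempty permutation avoiding 213 or 321 its last weak excedance i ↦ v. The rows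
-- below i only contain values smaller than v and stay weakly below the diagonal, so exc drops by
-- [i < v] and crs by v - i - 1 (by 0 if v = i). Conversely, the points that may be inserted into an
-- avoider have pairwise distinct offsets v - i, which fill an interval 0, …, a, and the new value
-- of a is a + 1 for the offset 0 and e for an offset e > 0. Both classes are thus encoded by the
-- same weighted words in e, where e = 0 has weight 1 and e > 0 has weight q pᵉ⁻¹. Writing F n a for
-- the total weight of the words of length n read from a, one finds
--   F n (a + 1) = F n a + q pᵃ Σ_{k < n} pᵏ F k a F (n - 1 - k) 1,
-- which for a = 0 is the recurrence of the q,p-Catalan numbers. Finally, reflection in the
-- antidiagonal takes 213 to 132 and preserves exc and crs.

open import Defs
open import Level using (Level)
open import Data.Bool using (true; false; if_then_else_)
open import Data.Nat as ℕ using (ℕ; zero; suc; _∸_; z≤n; s≤s)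
import Data.Nat.Properties as ℕP
open import Data.Fin as Fin using (Fin; zero; suc; toℕ; fromℕ<; punchIn; punchOut; opposite)
import Data.Fin.Properties as FP
import Data.Fin.Permutation as Perm
open import Data.Vec as Vec using (Vec; []; _∷_; lookup)
import Data.Vec.Properties as VecP
open import Data.List using (List; []; _∷_; _++_; map; concatMap; filter; length; applyUpTo; upTo; tabulate; allFin; cartesianProduct)
import Data.List.Properties as List
open import Data.List.Membership.Propositional using (_∈_)
open import Data.List.Membership.Propositional.Properties using (∈-map⁺; ∈-map⁻; ∈-filter⁺; ∈-filter⁻; ∈-allFin; ∈-tabulate⁺; ∈-concatMap⁺)
open import Data.List.Membership.Propositional.Properties.WithK using (unique∧set⇒bag)
open import Data.List.Relation.Binary.BagAndSetEquality using (∼bag⇒↭)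
open import Data.List.Relation.Binary.Permutation.Propositional as Perm↭ using (_↭_)
open import Data.List.Relation.Unary.Any as Any using (here; there)
open import Data.List.Relation.Unary.All as All using ([]; _∷_)
import Data.List.Relation.Unary.All.Properties as AllP
open import Data.List.Relation.Unary.AllPairs as AllPairs using (AllPairs; []; _∷_)
import Data.List.Relation.Unary.AllPairs.Properties as AllPairsP
open import Data.List.Relation.Unary.Unique.Propositional using (Unique)
import Data.List.Relation.Unary.Unique.Propositional.Properties as Unique
open import Data.Product using (_×_; _,_; proj₁; proj₂; ∃; ∃-syntax)
open import Data.Sum using (_⊎_; inj₁; inj₂; [_,_]′)
open import Function using (_∘_; id)
open import Function.Bundles using (mk⇔)
open import Relation.Nullary using (Dec; yes; no; does; ¬_; contradiction)
open import Relation.Nullary.Decidable using (_×-dec_; dec-true; dec-false; does-⇔)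
open import Relation.Unary using (Decidable)
open import Relation.Binary.Definitions using (tri<; tri≈; tri>)
open import Relation.Binary.PropositionalEquality using (_≡_; _≢_; cong; cong₂; subst; subst₂; module ≡-Reasoning)
open import Algebra.Bundles using (CommutativeSemiring)
import Algebra.Properties.CommutativeMonoid.Sum as CommutativeMonoidSum

-- Why the last weak excedance: all rows behind it lie strictly below the diagonal, so restoring it
-- affects the other points only in cells next to the diagonal, where the change can be counted
-- exactly. That the offsets form an interval is what reduces a permutation to a single number.
-- Origin of the identity for `F`: read the same word from a and from a + 1. The states differ by
-- one as long as the letters are 0 and agree after a common nonzero letter. The surplus of a + 1
-- therefore consists of the words that begin with j zeros and the letter a + 1 + j, and weighs q pᵃ
-- Σ_{j < n} pʲ F (n - 1 - j) (a + 1 + j). The obstacle is to see that this sum is the convolution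
-- with factors F k a and F (n - 1 - k) 1; `conv-suc` does so by showing that the convolution obeys
-- the recursion which splits off j = 0. It relies on the identity for the same n, so it is a step
-- inside the induction. A semiring has no subtraction, hence every difference is stated as a sum.

module CatalanTree {c ℓ : Level} (R : CommutativeSemiring c ℓ) (q p : CommutativeSemiring.Carrier R) where
  open CommutativeSemiring R
  open import Algebra.Definitions.RawSemiring rawSemiring using (_^_)
  open import Algebra.Solver.Ring.NaturalCoefficients.Default R using (solve; _:=_; _:+_; _:*_)
  open import Relation.Binary.Reasoning.Setoid setoid

  -- Weighted words and the q,p-Catalan recurrence.

  ∑ : ℕ → (ℕ → Carrier) → Carrier
  ∑ n f = sumR R (applyUpTo f n)

  ∑-cong : ∀ n {f g} → (∀ k → k ℕ.< n → f k ≈ g k) → ∑ n f ≈ ∑ n g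
  ∑-cong zero    _   = refl
  ∑-cong (suc n) f≈g = +-cong (f≈g 0 (s≤s z≤n)) (∑-cong n λ k k<n → f≈g (suc k) (s≤s k<n))

  ∑-distrib-+ : ∀ n f g → ∑ n (λ k → f k + g k) ≈ ∑ n f + ∑ n g
  ∑-distrib-+ zero    f g = sym (+-identityˡ 0#)
  ∑-distrib-+ (suc n) f g = trans (+-congˡ (∑-distrib-+ n (f ∘ suc) (g ∘ suc)))
    (solve 4 (λ a b x y → (a :+ b) :+ (x :+ y) := (a :+ x) :+ (b :+ y)) refl _ _ _ _)

  *-distribˡ-∑ : ∀ n x f → x * ∑ n f ≈ ∑ n (λ k → x * f k)
  *-distribˡ-∑ zero    x f = zeroʳ x
  *-distribˡ-∑ (suc n) x f = trans (distribˡ x _ _) (+-congˡ (*-distribˡ-∑ n x (f ∘ suc)))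

  ∑-zero : ∀ n → ∑ n (λ _ → 0#) ≈ 0#
  ∑-zero zero    = refl
  ∑-zero (suc n) = trans (+-identityˡ _) (∑-zero n)

  ∑-comm : ∀ m n (f : ℕ → ℕ → Carrier) → ∑ m (λ i → ∑ n (f i)) ≈ ∑ n (λ j → ∑ m (λ i → f i j))
  ∑-comm zero    n f = sym (∑-zero n)
  ∑-comm (suc m) n f = trans (+-congˡ (∑-comm m n (f ∘ suc))) (sym (∑-distrib-+ n (f 0) _))

  ∑-last : ∀ n f → ∑ (suc n) f ≈ ∑ n f + f n
  ∑-last zero    f = +-comm _ _
  ∑-last (suc n) f = trans (+-congˡ (∑-last n (f ∘ suc))) (sym (+-assoc _ _ _))

  -- The letter 0 leads from a to a + 1, the letter d + 1 with d < a leads to d + 1.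
  F : ℕ → ℕ → Carrier
  F zero    a = 1#
  F (suc n) a = F n (suc a) + q * ∑ a (λ d → p ^ d * F n (suc d))

  conv : ℕ → ℕ → Carrier
  conv n a = ∑ n (λ k → p ^ k * F k a * F (n ∸ suc k) 1)

  RaiseState : ℕ → Set ℓ
  RaiseState n = ∀ a → F n (suc a) ≈ F n a + q * (p ^ a * conv n a)

  -- The raising rule is added up over the states 1, ..., a. At state d + 1 its factor is
  -- `p ^ suc d`, which unfolds to `p * p ^ d`.
  telescope : ∀ n → RaiseState n → ∀ a →
              F n (suc a) ≈ F n 1 + q * ∑ a (λ d → p * p ^ d * conv n (suc d))
  telescope n raise zero    = sym (trans (+-congˡ (zeroʳ q)) (+-identityʳ _))
  telescope n raise (suc a) = begin
    F n (2 ℕ.+ a)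
      ≈⟨ raise (suc a) ⟩
    F n (suc a) + q * (p * p ^ a * conv n (suc a))
      ≈⟨ +-congʳ (telescope n raise a) ⟩
    F n 1 + q * ∑ a t + q * (p * p ^ a * conv n (suc a))
      ≈⟨ +-assoc _ _ _ ⟩
    F n 1 + (q * ∑ a t + q * t a)
      ≈⟨ +-congˡ (distribˡ q _ _) ⟨
    F n 1 + q * (∑ a t + t a)
      ≈⟨ +-congˡ (*-congˡ (∑-last a t)) ⟨
    F n 1 + q * ∑ (suc a) t ∎
    where t = λ d → p * p ^ d * conv n (suc d)

  -- The term k = 0 is `F n 1`. In the other terms `F (suc k) a` is expanded by its first letter:
  -- the letter 0 contributes `p * conv n (suc a)`, a letter d + 1 contributes a multiple of
  -- `conv n (suc d)`, and the latter telescope with `F n 1` to `F n (suc a)`.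
  conv-suc : ∀ n → RaiseState n → ∀ a → conv (suc n) a ≈ F n (suc a) + p * conv n (suc a)
  conv-suc n raise a = begin
    1# * 1# * F n 1 + ∑ n (λ k → p * p ^ k * F (suc k) a * G k)
      ≈⟨ +-cong (trans (*-congʳ (*-identityˡ 1#)) (*-identityˡ _)) (∑-cong n λ k _ → split k) ⟩
    F n 1 + ∑ n (λ k → p * (p ^ k * F k (suc a) * G k) + ∑ a (λ d → u d * v k d))
      ≈⟨ +-congˡ (∑-distrib-+ n _ _) ⟩
    F n 1 + (∑ n (λ k → p * (p ^ k * F k (suc a) * G k)) + ∑ n (λ k → ∑ a (λ d → u d * v k d)))
      ≈⟨ +-congˡ (+-cong (sym (*-distribˡ-∑ n p _)) (∑-comm n a _)) ⟩
    F n 1 + (p * conv n (suc a) + ∑ a (λ d → ∑ n (λ k → u d * v k d)))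
      ≈⟨ +-congˡ (+-congˡ (∑-cong a λ d _ → trans (sym (*-distribˡ-∑ n (u d) _)) (*-assoc q _ _))) ⟩
    F n 1 + (p * conv n (suc a) + ∑ a (λ d → q * (p * p ^ d * conv n (suc d))))
      ≈⟨ +-congˡ (+-congˡ (*-distribˡ-∑ a q _)) ⟨
    F n 1 + (p * conv n (suc a) + q * ∑ a (λ d → p * p ^ d * conv n (suc d)))
      ≈⟨ solve 3 (λ x y z → x :+ (y :+ z) := (x :+ z) :+ y) refl _ _ _ ⟩
    (F n 1 + q * ∑ a (λ d → p * p ^ d * conv n (suc d))) + p * conv n (suc a)
      ≈⟨ +-congʳ (telescope n raise a) ⟨
    F n (suc a) + p * conv n (suc a) ∎
    where
    G : ℕ → Carrier
    G k = F (n ∸ suc k) 1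
    u : ℕ → Carrier
    u d = q * (p * p ^ d)
    v : ℕ → ℕ → Carrier
    v k d = p ^ k * F k (suc d) * G k
    split : ∀ k → p * p ^ k * F (suc k) a * G k ≈
                  p * (p ^ k * F k (suc a) * G k) + ∑ a (λ d → u d * v k d)
    split k = begin
      p * p ^ k * (F k (suc a) + q * s) * G k
        ≈⟨ solve 6 (λ p pᵏ f q s g → p :* pᵏ :* (f :+ q :* s) :* g
                     := p :* (pᵏ :* f :* g) :+ q :* p :* pᵏ :* g :* s) refl p _ _ q s _ ⟩
      p * (p ^ k * F k (suc a) * G k) + q * p * p ^ k * G k * s
        ≈⟨ +-congˡ (*-distribˡ-∑ a _ _) ⟩
      p * (p ^ k * F k (suc a) * G k) + ∑ a (λ d → q * p * p ^ k * G k * (p ^ d * F k (suc d)))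
        ≈⟨ +-congˡ (∑-cong a λ d _ → solve 6 (λ q p pᵏ g pᵈ f → q :* p :* pᵏ :* g :* (pᵈ :* f)
                     := (q :* (p :* pᵈ)) :* (pᵏ :* f :* g)) refl q p _ _ _ _) ⟩
      p * (p ^ k * F k (suc a) * G k) + ∑ a (λ d → u d * v k d) ∎
      where s = ∑ a (λ d → p ^ d * F k (suc d))

  -- Raising the state changes the first step twice: the letter 0 leads to a + 2 instead of a + 1,
  -- which is the rule for n at a + 1, and the letter a + 1 becomes available. `conv-suc` merges the
  -- two surpluses.
  raiseState : ∀ n → RaiseState n
  raiseState zero    a = sym (trans (+-congˡ (trans (*-congˡ (zeroʳ _)) (zeroʳ q))) (+-identityʳ 1#))
  raiseState (suc n) a = begin
    F n (2 ℕ.+ a) + q * ∑ (suc a) g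
      ≈⟨ +-cong (raiseState n (suc a)) (*-congˡ (∑-last a g)) ⟩
    F n (suc a) + q * (p * p ^ a * conv n (suc a)) + q * (∑ a g + p ^ a * F n (suc a))
      ≈⟨ solve 6 (λ f q p pᵃ c s → f :+ q :* (p :* pᵃ :* c) :+ q :* (s :+ pᵃ :* f)
                   := (f :+ q :* s) :+ q :* (pᵃ :* (f :+ p :* c))) refl _ q p _ _ _ ⟩
    F (suc n) a + q * (p ^ a * (F n (suc a) + p * conv n (suc a)))
      ≈⟨ +-congˡ (*-congˡ (*-congˡ (conv-suc n (raiseState n) a))) ⟨
    F (suc n) a + q * (p ^ a * conv (suc n) a) ∎
    where g = λ d → p ^ d * F n (suc d)

  F-start : ∀ n → F (suc n) 0 ≈ F n 1
  F-start n = trans (+-congˡ (zeroʳ q)) (+-identityʳ _)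

  catF≈F : ∀ f m → m ℕ.≤ f → catF R q p f m ≈ F m 0
  catF≈F zero    zero          _         = refl
  catF≈F (suc f) zero          _         = refl
  catF≈F (suc f) (suc zero)    _         = sym (F-start 0)
  catF≈F (suc f) (suc (suc m)) (s≤s m<f) = begin
    catF R q p f (suc m) + q * sumR R (map t (upTo (suc m)))
      ≡⟨ cong (λ ts → catF R q p f (suc m) + q * sumR R ts) (List.map-upTo t (suc m)) ⟩
    catF R q p f (suc m) + q * ∑ (suc m) t
      ≈⟨ +-cong (catF≈F f (suc m) m<f) (*-congˡ (∑-cong (suc m) t≈)) ⟩
    F (suc m) 0 + q * conv (suc m) 0
      ≈⟨ +-congˡ (*-congˡ (*-identityˡ _)) ⟨
    F (suc m) 0 + q * (1# * conv (suc m) 0)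
      ≈⟨ raiseState (suc m) 0 ⟨
    F (suc m) 1
      ≈⟨ F-start (suc m) ⟨
    F (2 ℕ.+ m) 0 ∎
    where
    t : ℕ → Carrier
    t k = p ^ k * catF R q p f k * catF R q p f (suc m ∸ k)
    t≈ : ∀ k → k ℕ.< suc m → t k ≈ p ^ k * F k 0 * F (suc m ∸ suc k) 1
    -- As k ≤ m, the index m + 1 - k is positive, so one forced letter 0 can be split off, which
    -- turns state 0 into state 1.
    t≈ k (s≤s k≤m) = *-cong
      (*-congˡ (catF≈F f k (ℕP.≤-trans k≤m (ℕP.<⇒≤ m<f))))
      (trans (catF≈F f (suc m ∸ k) (ℕP.≤-trans (ℕP.m∸n≤m (suc m) k) m<f))
        (trans (reflexive (cong (λ j → F j 0) (ℕP.+-∸-assoc 1 k≤m))) (F-start (m ∸ k))))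

open import Data.Nat using (_+_)
open import Relation.Binary.PropositionalEquality using (refl; sym; trans)
open CommutativeMonoidSum ℕP.+-0-commutativeMonoid
  using (sum; sum-remove; sum-permute; sum-cong-≗; sum-replicate-zero; ∑-distrib-+; ∑-comm)

private variable
  n : ℕ
  a b : Level

infixl 8 _!_
_!_ : ∀ {A : Set} → Vec A n → Fin n → A
_!_ = lookup

-- Counting with indicators

ind : {P : Set a} → Dec P → ℕ
ind P? = if does P? then 1 else 0

ind-yes : {P : Set a} (P? : Dec P) → P → ind P? ≡ 1
ind-yes P? x = cong (if_then 1 else 0) (dec-true P? x)

ind-no : {P : Set a} (P? : Dec P) → ¬ P → ind P? ≡ 0
ind-no P? x = cong (if_then 1 else 0) (dec-false P? x)

module _ {P : Set a} {Q : Set b} (P? : Dec P) (Q? : Dec Q) where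

  ind-⇔ : (P → Q) → (Q → P) → ind P? ≡ ind Q?
  ind-⇔ f g = cong (if_then 1 else 0) (does-⇔ (mk⇔ f g) P? Q?)

  ind-⊎ : ∀ {c} {S : Set c} (S? : Dec S) →
          (P → Q ⊎ S) → (Q → P) → (S → P) → ¬ (Q × S) → ind P? ≡ ind Q? + ind S?
  ind-⊎ (yes z) f g h d = trans (ind-yes P? (h z)) (cong (_+ 1) (sym (ind-no Q? λ y → d (y , z))))
  ind-⊎ (no  z) f g h d = trans (ind-⇔ (λ x → [ id , (λ y → contradiction y z) ]′ (f x)) g)
                                (sym (ℕP.+-identityʳ _))

sum-zero : (f : Fin n → ℕ) → (∀ i → f i ≡ 0) → sum f ≡ 0
sum-zero {n} f f≡0 = trans (sum-cong-≗ f≡0) (sum-replicate-zero n)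

module _ {P : Fin n → Set a} {Q : Fin n → Set b} (P? : Decidable P) (Q? : Decidable Q) where

  sum-ind-⇔ : (∀ i → P i → Q i) → (∀ i → Q i → P i) →
              sum (λ i → ind (P? i)) ≡ sum (λ i → ind (Q? i))
  sum-ind-⇔ f g = sum-cong-≗ λ i → ind-⇔ (P? i) (Q? i) (f i) (g i)

sum-ind-unique : {P : Fin n → Set a} (P? : Decidable P) {Q : Set b} (Q? : Dec Q) →
                 (Q → ∃ P) → (∀ i → P i → Q) → (∀ i j → P i → P j → i ≡ j) →
                 sum (λ i → ind (P? i)) ≡ ind Q?
sum-ind-unique P? (no  x) f g u = sum-zero _ λ i → ind-no (P? i) (x ∘ g i)
sum-ind-unique {n = zero}  P? (yes x) f g u with () ← proj₁ (f x)
sum-ind-unique {n = suc n} P? (yes x) f g u with i , Pi ← f x = begin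
  sum (λ i → ind (P? i))                               ≡⟨ sum-remove {i = i} (λ i → ind (P? i)) ⟩
  ind (P? i) + sum (λ j → ind (P? (punchIn i j)))      ≡⟨ cong₂ _+_ (ind-yes (P? i) Pi) (sum-zero _ others) ⟩
  1                                                    ∎
  where
  open ≡-Reasoning
  others : ∀ j → ind (P? (punchIn i j)) ≡ 0
  others j = ind-no (P? (punchIn i j)) λ Pj → FP.punchInᵢ≢i i j (u _ _ Pj Pi)

sum-below : ∀ n b → b ℕ.≤ n → sum {n} (λ y → ind (toℕ y ℕ.<? b)) ≡ b
sum-below n       zero    _         = sum-zero {n} _ λ _ → refl
sum-below (suc n) (suc b) (s≤s b≤n) =
  cong suc (trans (sum-ind-⇔ {n} (λ y → suc (toℕ y) ℕ.<? suc b) (λ y → toℕ y ℕ.<? b)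
                             (λ _ → ℕ.s≤s⁻¹) (λ _ → s≤s))
                  (sum-below n b b≤n))

between? : ∀ a b (y : ℕ) → Dec (a ℕ.< y × y ℕ.< b)
between? a b y = a ℕ.<? y ×-dec y ℕ.<? b

-- Truncated subtraction also covers b ≤ a, where nothing lies between; a new fixed point needs this
-- case.
sum-between : ∀ n a b → b ℕ.≤ n → sum {n} (λ y → ind (between? a b (toℕ y))) ≡ b ∸ suc a
sum-between n       a       zero    _         = sum-zero {n} _ λ y → ind-no (between? a 0 (toℕ y)) λ ()
sum-between (suc n) zero    (suc b) (s≤s b≤n) =
  trans (sum-ind-⇔ {n} (λ y → between? 0 (suc b) (suc (toℕ y))) (λ y → toℕ y ℕ.<? b)
                   (λ _ → ℕ.s≤s⁻¹ ∘ proj₂) (λ _ y<b → s≤s z≤n , s≤s y<b))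
        (sum-below n b b≤n)
sum-between (suc n) (suc a) (suc b) (s≤s b≤n) =
  trans (sum-ind-⇔ {n} (λ y → between? (suc a) (suc b) (suc (toℕ y))) (λ y → between? a b (toℕ y))
                   (λ _ (l , r) → ℕ.s≤s⁻¹ l , ℕ.s≤s⁻¹ r) (λ _ (l , r) → s≤s l , s≤s r))
        (sum-between n a b b≤n)

length-filter-tabulate : {A : Set a} {P : A → Set b} (P? : Decidable P) (f : Fin n → A) →
                         length (filter P? (tabulate f)) ≡ sum (λ i → ind (P? (f i)))
length-filter-tabulate {n = zero}  P? f = refl
length-filter-tabulate {n = suc n} P? f with does (P? (f zero))
... | true  = cong suc (length-filter-tabulate P? (f ∘ suc))
... | false = length-filter-tabulate P? (f ∘ suc)

length-filter-× : ∀ {m} {P : Fin m × Fin n → Set b} (P? : Decidable P) →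
                  length (filter P? (cartesianProduct (allFin m) (allFin n))) ≡
                  sum (λ i → sum (λ j → ind (P? (i , j))))
length-filter-× {n = n} {P = P} P? = go id
  where
  open ≡-Reasoning
  -- Only the left factor is generalised to `tabulate f`, so that the induction can pass to
  -- `f ∘ suc`.
  go : ∀ {k} (f : Fin k → Fin _) → length (filter P? (cartesianProduct (tabulate f) (allFin n))) ≡
                                   sum (λ i → sum (λ j → ind (P? (f i , j))))
  go {zero}  f = refl
  go {suc k} f = begin
    length (filter P? (map (f zero ,_) (allFin n) ++ rest))
      ≡⟨ cong length (List.filter-++ P? (map (f zero ,_) (allFin n)) rest) ⟩
    length (filter P? (map (f zero ,_) (allFin n)) ++ filter P? rest)
      ≡⟨ List.length-++ (filter P? (map (f zero ,_) (allFin n))) ⟩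
    length (filter P? (map (f zero ,_) (allFin n))) + length (filter P? rest)
      ≡⟨ cong₂ _+_ (trans (cong (length ∘ filter P?) (List.map-tabulate id (f zero ,_)))
                          (length-filter-tabulate P? (f zero ,_)))
                   (go (f ∘ suc)) ⟩
    sum (λ i → sum (λ j → ind (P? (f i , j)))) ∎
    where rest = cartesianProduct (tabulate (f ∘ suc)) (allFin n)

exc≡sum : (σ : Vec (Fin n) n) → exc σ ≡ sum (λ i → ind (i Fin.<? σ ! i))
exc≡sum σ = length-filter-tabulate (λ i → i Fin.<? σ ! i) id

crs≡sum : (σ : Vec (Fin n) n) → crs σ ≡ sum (λ i → sum (λ j → ind (crossing? σ (i , j))))
crs≡sum σ = length-filter-× (crossing? σ)

-- Permutations

injective⇒surjective : (f : Fin n → Fin n) → (∀ {i j} → f i ≡ f j → i ≡ j) → ∀ y → ∃ λ x → f x ≡ y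
injective⇒surjective {suc n} f inj y with FP.any? (λ x → f x FP.≟ y)
... | yes hit = hit
-- Pigeonhole: if y were missed, punching it out of the codomain would leave an injection into a
-- smaller set.
... | no miss = contradiction (FP.injective⇒≤ {f = λ x → punchOut (y≢f x)} (inj ∘ FP.punchOut-injective (y≢f _) (y≢f _))) ℕP.1+n≰n
  where
  y≢f : ∀ x → y ≢ f x
  y≢f x y≡fx = miss (x , sym y≡fx)

module _ {σ : Vec (Fin n) n} (perm : IsPerm σ) where

  preimage : ∀ y → ∃ λ x → σ ! x ≡ y
  preimage = injective⇒surjective (σ !_) (perm _ _)

  toPermutation : Perm.Permutation n n
  toPermutation = Perm.permutation (σ !_) (proj₁ ∘ preimage) (proj₂ ∘ preimage)
    (λ x → perm _ _ (proj₂ (preimage (σ ! x))))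

-- Insertion of a point

ins : Fin (suc n) → Fin (suc n) → Vec (Fin n) n → Vec (Fin (suc n)) (suc n)
ins i v τ = Vec.insertAt (Vec.map (punchIn v) τ) i v

module _ (i v : Fin (suc n)) (τ : Vec (Fin n) n) where

  ins-here : ins i v τ ! i ≡ v
  ins-here = VecP.insertAt-lookup (Vec.map (punchIn v) τ) i v

  ins-there : ∀ j → ins i v τ ! punchIn i j ≡ punchIn v (τ ! j)
  ins-there j = trans (VecP.insertAt-punchIn (Vec.map (punchIn v) τ) i v j) (VecP.lookup-map j (punchIn v) τ)

data Row (i : Fin (suc n)) : Fin (suc n) → Set where
  here  : Row i i
  there : ∀ j → Row i (punchIn i j)

row : (i r : Fin (suc n)) → Row i r
row i r with i FP.≟ r
... | yes refl = here
... | no  i≢r  = subst (Row i) (FP.punchIn-punchOut i≢r) (there (punchOut i≢r))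

lookup-injective : ∀ {A : Set} {xs ys : Vec A n} → (∀ i → xs ! i ≡ ys ! i) → xs ≡ ys
lookup-injective {xs = xs} {ys} eq =
  trans (sym (VecP.tabulate∘lookup xs)) (trans (VecP.tabulate-cong eq) (VecP.tabulate∘lookup ys))

ins-perm : ∀ {τ} (i v : Fin (suc n)) → IsPerm τ → IsPerm (ins i v τ)
ins-perm {τ = τ} i v perm r s eq with row i r | row i s
... | here    | here    = refl
... | here    | there k = contradiction
  (trans (sym (ins-there i v τ k)) (trans (sym eq) (ins-here i v τ))) (FP.punchInᵢ≢i v (τ ! k))
... | there j | here    = contradiction
  (trans (sym (ins-there i v τ j)) (trans eq (ins-here i v τ))) (FP.punchInᵢ≢i v (τ ! j))
... | there j | there k = cong (punchIn i) (perm j k (FP.punchIn-injective v _ _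
  (trans (sym (ins-there i v τ j)) (trans eq (ins-there i v τ k)))))

ins-perm⁻ : ∀ {τ} (i v : Fin (suc n)) → IsPerm (ins i v τ) → IsPerm τ
ins-perm⁻ {τ = τ} i v perm j k eq = FP.punchIn-injective i j k (perm _ _
  (trans (ins-there i v τ j) (trans (cong (punchIn v) eq) (sym (ins-there i v τ k)))))

ins-injective : ∀ {τ τ′} (i v : Fin (suc n)) → ins i v τ ≡ ins i v τ′ → τ ≡ τ′
ins-injective {τ = τ} {τ′} i v eq = lookup-injective λ j → FP.punchIn-injective v _ _
  (trans (sym (ins-there i v τ j)) (trans (cong (_! punchIn i j) eq) (ins-there i v τ′ j)))

del : ∀ {σ} → IsPerm {suc n} σ → ∀ i → ∃ λ v → ∃ λ τ → ins i v τ ≡ σ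
del {n = n} {σ} perm i = σ ! i , τ , lookup-injective agree
  where
  v≢ : ∀ j → σ ! i ≢ σ ! punchIn i j
  v≢ j eq = FP.punchInᵢ≢i i j (perm _ _ (sym eq))
  τ : Vec (Fin n) n
  τ = Vec.tabulate λ j → punchOut (v≢ j)
  agree : ∀ r → ins i (σ ! i) τ ! r ≡ σ ! r
  agree r with row i r
  ... | here    = ins-here i _ τ
  ... | there j = trans (ins-there i _ τ j)
    (trans (cong (punchIn (σ ! i)) (VecP.lookup∘tabulate _ j)) (FP.punchIn-punchOut (v≢ j)))

punchIn-below : (i : Fin (suc n)) (j : Fin n) → j Fin.< i → toℕ (punchIn i j) ≡ toℕ j
punchIn-below (suc i) zero    _         = refl
punchIn-below (suc i) (suc j) (s≤s j<i) = cong suc (punchIn-below i j j<i)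

punchIn-above : (i : Fin (suc n)) (j : Fin n) → i Fin.≤ j → toℕ (punchIn i j) ≡ suc (toℕ j)
punchIn-above zero    j       _         = refl
punchIn-above (suc i) (suc j) (s≤s i≤j) = cong suc (punchIn-above i j i≤j)

punchIn-mono-< : (i : Fin (suc n)) (j k : Fin n) → j Fin.< k → punchIn i j Fin.< punchIn i k
punchIn-mono-< i j k j<k = ℕP.≰⇒> λ le → ℕP.<⇒≱ j<k (FP.punchIn-cancel-≤ i k j le)

punchIn-cancel-< : (i : Fin (suc n)) (j k : Fin n) → punchIn i j Fin.< punchIn i k → j Fin.< k
punchIn-cancel-< i j k lt = ℕP.≰⇒> λ k≤j → ℕP.<⇒≱ lt (FP.punchIn-mono-≤ i k j k≤j)

module _ (i : Fin (suc n)) (j : Fin n) where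

  private
    below : j Fin.< i → toℕ (punchIn i j) ≡ toℕ j
    below = punchIn-below i j
    above : i Fin.≤ j → toℕ (punchIn i j) ≡ suc (toℕ j)
    above = punchIn-above i j

  ≤-punchIn : ∀ {x} → x ℕ.≤ toℕ j → x ℕ.≤ toℕ (punchIn i j)
  ≤-punchIn x≤j with ℕP.<-≤-connex (toℕ j) (toℕ i)
  ... | inj₁ j<i = ℕP.≤-trans x≤j (ℕP.≤-reflexive (sym (below j<i)))
  ... | inj₂ i≤j = ℕP.≤-trans (ℕP.m≤n⇒m≤1+n x≤j) (ℕP.≤-reflexive (sym (above i≤j)))

  punchIn-≤ : ∀ {x} → toℕ (punchIn i j) ℕ.≤ x → toℕ j ℕ.≤ x
  punchIn-≤ = ℕP.≤-trans (≤-punchIn ℕP.≤-refl)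

  punchIn-≤-suc : toℕ (punchIn i j) ℕ.≤ suc (toℕ j)
  punchIn-≤-suc with ℕP.<-≤-connex (toℕ j) (toℕ i)
  ... | inj₁ j<i = ℕP.≤-trans (ℕP.≤-reflexive (below j<i)) (ℕP.n≤1+n _)
  ... | inj₂ i≤j = ℕP.≤-reflexive (above i≤j)

  <-punchIn⁻ : ∀ {x} → x ℕ.≤ toℕ i → x ℕ.≤ toℕ (punchIn i j) → x ℕ.≤ toℕ j
  <-punchIn⁻ x≤i x≤p with ℕP.<-≤-connex (toℕ j) (toℕ i)
  ... | inj₁ j<i = ℕP.≤-trans x≤p (ℕP.≤-reflexive (below j<i))
  ... | inj₂ i≤j = ℕP.≤-trans x≤i i≤j

  punchIn-<⁻ : ∀ {w} → toℕ i ℕ.≤ w → toℕ (punchIn i j) ℕ.< suc w → toℕ j ℕ.< w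
  punchIn-<⁻ i≤w p<w with ℕP.<-≤-connex (toℕ j) (toℕ i)
  ... | inj₁ j<i = ℕP.<-≤-trans j<i i≤w
  ... | inj₂ i≤j = ℕ.s≤s⁻¹ (ℕP.≤-trans (s≤s (ℕP.≤-reflexive (sym (above i≤j)))) p<w)

  punchIn-<-suc : ∀ {w} → toℕ j ℕ.< w → toℕ (punchIn i j) ℕ.< suc w
  punchIn-<-suc j<w = s≤s (ℕP.≤-trans punchIn-≤-suc j<w)

  punchIn-above⁻ : toℕ i ℕ.< toℕ (punchIn i j) → toℕ i ℕ.≤ toℕ j
  punchIn-above⁻ i<p = <-punchIn⁻ ℕP.≤-refl (ℕP.<⇒≤ i<p)

  <-punchIn : toℕ i ℕ.≤ toℕ j → toℕ i ℕ.< toℕ (punchIn i j)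
  <-punchIn i≤j = ℕP.≤-trans (s≤s i≤j) (ℕP.≤-reflexive (sym (above i≤j)))

  punchIn-below⁻ : toℕ (punchIn i j) ℕ.< toℕ i → toℕ j ℕ.< toℕ i
  punchIn-below⁻ p<i = ℕP.≤-<-trans (≤-punchIn ℕP.≤-refl) p<i

  punchIn-< : toℕ j ℕ.< toℕ i → toℕ (punchIn i j) ℕ.< toℕ i
  punchIn-< j<i = ℕP.≤-trans (s≤s (ℕP.≤-reflexive (below j<i))) j<i

-- Row b and value a both shift when b ≥ i and a ≥ v; since i ≤ v, the only cells whose position
-- relative to the diagonal changes lie just above it, in rows from i on and values less than v.
module _ (i v : Fin (suc n)) (i≤v : i Fin.≤ v) (a b : Fin n) where

  punchIn-≤⁻ : punchIn v a Fin.≤ punchIn i b →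
               a Fin.≤ b ⊎ (toℕ a ≡ suc (toℕ b) × i Fin.≤ b × a Fin.< v)
  punchIn-≤⁻ le with ℕP.<-≤-connex (toℕ b) (toℕ i) | ℕP.<-≤-connex (toℕ a) (toℕ v)
  ... | inj₁ b<i | _ = inj₁ (punchIn-≤ v a (ℕP.≤-trans le (ℕP.≤-reflexive (punchIn-below i b b<i))))
  ... | inj₂ i≤b | inj₂ v≤a = inj₁ (ℕ.s≤s⁻¹ (subst₂ ℕ._≤_ (punchIn-above v a v≤a) (punchIn-above i b i≤b) le))
  ... | inj₂ i≤b | inj₁ a<v with ℕP.m≤n⇒m<n∨m≡n (subst₂ ℕ._≤_ (punchIn-below v a a<v) (punchIn-above i b i≤b) le)
  ...   | inj₁ a<1+b = inj₁ (ℕ.s≤s⁻¹ a<1+b)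
  ...   | inj₂ a≡1+b = inj₂ (a≡1+b , i≤b , a<v)

  punchIn-≤⁺ : a Fin.≤ b → punchIn v a Fin.≤ punchIn i b
  punchIn-≤⁺ a≤b with ℕP.<-≤-connex (toℕ b) (toℕ i) | ℕP.<-≤-connex (toℕ a) (toℕ v)
  ... | inj₁ b<i | inj₁ a<v = ≤-punchIn i b (ℕP.≤-trans (ℕP.≤-reflexive (punchIn-below v a a<v)) a≤b)
  ... | inj₁ b<i | inj₂ v≤a = contradiction (ℕP.≤-trans i≤v (ℕP.≤-trans v≤a a≤b)) (ℕP.<⇒≱ b<i)
  ... | inj₂ i≤b | _ = ℕP.≤-trans (punchIn-≤-suc v a) (ℕP.≤-trans (s≤s a≤b) (ℕP.≤-reflexive (sym (punchIn-above i b i≤b))))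

  punchIn-≤-diagonal : toℕ a ≡ suc (toℕ b) → i Fin.≤ b → a Fin.< v → punchIn v a Fin.≤ punchIn i b
  punchIn-≤-diagonal a≡1+b i≤b a<v =
    ℕP.≤-reflexive (trans (punchIn-below v a a<v) (trans a≡1+b (sym (punchIn-above i b i≤b))))

-- A new point (i , v) of this kind becomes the last weak excedance and a right-to-left maximum.
record Insertable (τ : Vec (Fin n) n) (i v : Fin (suc n)) : Set where
  field
    weakExc : i Fin.≤ v
    top     : ∀ r → i Fin.≤ r → τ ! r Fin.< v
    low     : ∀ r → i Fin.≤ r → τ ! r Fin.≤ r

-- How an insertion changes excedances and crossings.

module InsertStats {τ : Vec (Fin n) n} {i v : Fin (suc n)} (insertable : Insertable τ i v) where
  open Insertable insertable

  private
    σ = ins i v τ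
    σ-here = ins-here i v τ
    σ-there = ins-there i v τ

  -- An old row could lose its excedance only from a cell just above the diagonal in a row from i
  -- on, and `low` leaves no such cell occupied.
  exc-ins : exc σ ≡ ind (i Fin.<? v) + exc τ
  exc-ins = begin
    exc σ
      ≡⟨ exc≡sum σ ⟩
    sum (λ r → ind (r Fin.<? σ ! r))
      ≡⟨ sum-remove {i = i} (λ r → ind (r Fin.<? σ ! r)) ⟩
    ind (i Fin.<? σ ! i) + sum (λ j → ind (punchIn i j Fin.<? σ ! punchIn i j))
      ≡⟨ cong₂ _+_ (cong (λ w → ind (i Fin.<? w)) σ-here)
                   (sum-ind-⇔ (λ j → punchIn i j Fin.<? σ ! punchIn i j) (λ j → j Fin.<? τ ! j) down up) ⟩
    ind (i Fin.<? v) + sum (λ j → ind (j Fin.<? τ ! j))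
      ≡⟨ cong (ind (i Fin.<? v) +_) (exc≡sum τ) ⟨
    ind (i Fin.<? v) + exc τ ∎
    where
    open ≡-Reasoning
    down : ∀ j → punchIn i j Fin.< σ ! punchIn i j → j Fin.< τ ! j
    down j lt = ℕP.≰⇒> λ τj≤j → ℕP.<⇒≱ lt
      (subst (Fin._≤ punchIn i j) (sym (σ-there j)) (punchIn-≤⁺ i v weakExc (τ ! j) j τj≤j))
    up : ∀ j → j Fin.< τ ! j → punchIn i j Fin.< σ ! punchIn i j
    up j lt = ℕP.≰⇒> λ le →
      [ ℕP.<⇒≱ lt , (λ (_ , i≤j , _) → ℕP.<⇒≱ lt (low j i≤j)) ]′
      (punchIn-≤⁻ i v weakExc (τ ! j) j (subst (Fin._≤ punchIn i j) (σ-there j) le))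

  private
    -- The crossings of σ not coming from τ involve the new arc (Left) or two rows j and k with
    -- τ k = j + 1, which the insertion moves to a common diagonal position (Diag); counted by k,
    -- the latter amount to Right.
    Fresh : Fin n → Set
    Fresh k = i Fin.< τ ! k × τ ! k Fin.< v

    Left : Fin n → Set
    Left k = k Fin.< i × Fresh k

    Right : Fin n → Set
    Right k = i Fin.≤ k × Fresh k

    Diag : Fin n → Fin n → Set
    Diag j k = i Fin.≤ k × i Fin.≤ j × toℕ (τ ! k) ≡ suc (toℕ j) × τ ! k Fin.< v

    fresh? : ∀ k → Dec (Fresh k)
    fresh? k = between? (toℕ i) (toℕ v) (toℕ (τ ! k))

    left? : ∀ k → Dec (Left k)
    left? k = k Fin.<? i ×-dec fresh? k

    right? : ∀ k → Dec (Right k)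
    right? k = i Fin.≤? k ×-dec fresh? k

    diag? : ∀ j k → Dec (Diag j k)
    diag? j k = i Fin.≤? k ×-dec i Fin.≤? j ×-dec toℕ (τ ! k) ℕ.≟ suc (toℕ j) ×-dec τ ! k Fin.<? v

  σ-above : ∀ r → i Fin.< r → σ ! r Fin.< v
  σ-above r i<r with row i r
  ... | here    = contradiction i<r (ℕP.<-irrefl refl)
  ... | there j = subst (Fin._< v) (sym (σ-there j)) (punchIn-< v _ (top j (punchIn-above⁻ i j i<r)))

  -- Behind i the row numbers grow by one while the values, being less than v, stay. So `low`
  -- becomes strict, which makes i the last weak excedance.
  σ-below-diagonal : ∀ r → i Fin.< r → σ ! r Fin.< r
  σ-below-diagonal r i<r with row i r
  ... | here    = contradiction i<r (ℕP.<-irrefl refl)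
  ... | there j = let i≤j = punchIn-above⁻ i j i<r in
    subst₂ ℕ._<_ (sym (trans (cong toℕ (σ-there j)) (punchIn-below v (τ ! j) (top j i≤j))))
                 (sym (punchIn-above i j i≤j)) (s≤s (low j i≤j))

  private
    no-crossing-from-i : ∀ r → ¬ Crossing σ (i , r)
    no-crossing-from-i r (inj₁ (i<r , _ , lt)) =
      ℕP.<-asym (subst (Fin._< σ ! r) σ-here lt) (σ-above r i<r)
    no-crossing-from-i r (inj₂ (lt , σr≤i , i<r)) =
      ℕP.<-asym (subst (Fin._< σ ! r) σ-here lt) (σ-above r i<r)

    crossing-into-i : ∀ j → Crossing σ (punchIn i j , i) → Left j
    crossing-into-i j (inj₁ (p<i , i<σp , σp<σi)) =
      j<i , ℕP.<-≤-trans i<τ′ (ℕP.≤-reflexive τ′≡) , punchIn-below⁻ v (τ ! j) τ′<v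
      where
      j<i = punchIn-below⁻ i j p<i
      i<τ′ = subst (i Fin.<_) (σ-there j) i<σp
      τ′<v = subst₂ Fin._<_ (σ-there j) σ-here σp<σi
      τ′≡ = punchIn-below v (τ ! j) (punchIn-below⁻ v (τ ! j) τ′<v)
    crossing-into-i j (inj₂ (_ , σi≤p , p<i)) =
      contradiction (ℕP.≤-trans weakExc (subst (Fin._≤ punchIn i j) σ-here σi≤p)) (ℕP.<⇒≱ p<i)

    left-crosses-i : ∀ j → Left j → Crossing σ (punchIn i j , i)
    left-crosses-i j (j<i , i<τj , τj<v) = inj₁
      ( punchIn-< i j j<i
      , subst (i Fin.<_) (sym (σ-there j)) (≤-punchIn v (τ ! j) i<τj)
      , subst₂ Fin._<_ (sym (σ-there j)) (sym σ-here) (punchIn-< v (τ ! j) τj<v))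

    -- An upper crossing always descends to τ. For a lower one the inequality `τ ! k ≤ j` may fail,
    -- but only by one, and then `Diag` holds.
    crossing-down : ∀ j k → Crossing σ (punchIn i j , punchIn i k) → Crossing τ (j , k) ⊎ Diag j k
    crossing-down j k (inj₁ (pj<pk , pk<σpj , σpj<σpk)) = inj₁ (inj₁
      ( punchIn-cancel-< i j k pj<pk
      , ℕP.≰⇒> (λ τj≤k → ℕP.<⇒≱ (subst (punchIn i k Fin.<_) (σ-there j) pk<σpj)
                                 (punchIn-≤⁺ i v weakExc (τ ! j) k τj≤k))
      , punchIn-cancel-< v _ _ (subst₂ Fin._<_ (σ-there j) (σ-there k) σpj<σpk)))
    crossing-down j k (inj₂ (σpj<σpk , σpk≤pj , pj<pk))
      with punchIn-≤⁻ i v weakExc (τ ! k) j (subst (Fin._≤ punchIn i j) (σ-there k) σpk≤pj)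
    ... | inj₁ τk≤j = inj₁ (inj₂
      (punchIn-cancel-< v _ _ (subst₂ Fin._<_ (σ-there j) (σ-there k) σpj<σpk)
      , τk≤j , punchIn-cancel-< i j k pj<pk))
    ... | inj₂ (τk≡1+j , i≤j , τk<v) =
      inj₂ (ℕP.≤-trans i≤j (ℕP.<⇒≤ (punchIn-cancel-< i j k pj<pk)) , i≤j , τk≡1+j , τk<v)

    crossing-up : ∀ j k → Crossing τ (j , k) → Crossing σ (punchIn i j , punchIn i k)
    crossing-up j k (inj₁ (j<k , k<τj , τj<τk)) = inj₁
      ( punchIn-mono-< i j k j<k
      , subst (punchIn i k Fin.<_) (sym (σ-there j)) (ℕP.≰⇒> stays)
      , subst₂ Fin._<_ (sym (σ-there j)) (sym (σ-there k)) (punchIn-mono-< v _ _ τj<τk))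
      where
      stays : ¬ punchIn v (τ ! j) Fin.≤ punchIn i k
      stays le with punchIn-≤⁻ i v weakExc (τ ! j) k le
      ... | inj₁ τj≤k         = ℕP.<⇒≱ k<τj τj≤k
      ... | inj₂ (_ , i≤k , _) = ℕP.<⇒≱ (ℕP.<-trans k<τj τj<τk) (low k i≤k)
    crossing-up j k (inj₂ (τj<τk , τk≤j , j<k)) = inj₂
      ( subst₂ Fin._<_ (sym (σ-there j)) (sym (σ-there k)) (punchIn-mono-< v _ _ τj<τk)
      , subst (Fin._≤ punchIn i j) (sym (σ-there k)) (punchIn-≤⁺ i v weakExc (τ ! k) j τk≤j)
      , punchIn-mono-< i j k j<k)

    diag-crosses : ∀ j k → Diag j k → Crossing σ (punchIn i j , punchIn i k)
    diag-crosses j k (i≤k , i≤j , τk≡1+j , τk<v) = inj₂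
      ( subst₂ Fin._<_ (sym (σ-there j)) (sym (σ-there k)) (punchIn-mono-< v _ _ τj<τk)
      , subst (Fin._≤ punchIn i j) (sym (σ-there k)) (punchIn-≤-diagonal i v weakExc (τ ! k) j τk≡1+j i≤j τk<v)
      , punchIn-mono-< i j k j<k)
      where
      τj<τk : τ ! j Fin.< τ ! k
      τj<τk = ℕP.≤-trans (s≤s (low j i≤j)) (ℕP.≤-reflexive (sym τk≡1+j))
      j<k : j Fin.< k
      j<k = ℕP.≤-trans (ℕP.≤-reflexive (sym τk≡1+j)) (low k i≤k)

    diag-disjoint : ∀ j k → ¬ (Crossing τ (j , k) × Diag j k)
    diag-disjoint j k (inj₁ (_ , k<τj , τj<τk) , i≤k , _)  = ℕP.<⇒≱ (ℕP.<-trans k<τj τj<τk) (low k i≤k)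
    diag-disjoint j k (inj₂ (_ , τk≤j , _) , _ , _ , τk≡1+j , _) =
      ℕP.<⇒≱ (ℕP.≤-reflexive (sym τk≡1+j)) τk≤j

    sum-diag : ∀ k → sum (λ j → ind (diag? j k)) ≡ ind (right? k)
    sum-diag k = sum-ind-unique (λ j → diag? j k) (right? k) find
      (λ j (i≤k , i≤j , eq , lt) → i≤k , ℕP.≤-trans (s≤s i≤j) (ℕP.≤-reflexive (sym eq)) , lt)
      (λ j j′ (_ , _ , eq , _) (_ , _ , eq′ , _) →
        FP.toℕ-injective (ℕP.suc-injective (trans (sym eq) eq′)))
      where
      find : Right k → ∃ λ j → Diag j k
      find (i≤k , i<τk , τk<v) with τ ! k | i<τk
      -- The partner row is j = τ k - 1; it exists and is at least i because i < τ k.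
      ... | suc t | s≤s i≤t = Fin.inject₁ t ,
        i≤k , subst (toℕ i ℕ.≤_) (sym (FP.toℕ-inject₁ t)) i≤t , cong suc (sym (FP.toℕ-inject₁ t)) , τk<v

  -- Each value strictly between i and v causes exactly one new crossing: with the new arc if its
  -- row lies before i, with a diagonal partner otherwise. A permutation takes each of these values
  -- once, so the count depends on i and v alone.
  crs-ins : IsPerm τ → crs σ ≡ (toℕ v ∸ suc (toℕ i)) + crs τ
  crs-ins perm = begin
    crs σ
      ≡⟨ crs≡sum σ ⟩
    sum (λ r → sum (λ s → χ r s))
      ≡⟨ sum-remove {i = i} (λ r → sum (χ r)) ⟩
    sum (χ i) + sum (λ j → sum (χ (punchIn i j)))
      ≡⟨ cong (_+ sum (λ j → sum (χ (punchIn i j))))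
              (sum-zero (χ i) λ r → ind-no (crossing? σ (i , r)) (no-crossing-from-i r)) ⟩
    sum (λ j → sum (χ (punchIn i j)))
      ≡⟨ sum-cong-≗ (λ j → sum-remove {i = i} (χ (punchIn i j))) ⟩
    sum (λ j → χ (punchIn i j) i + sum (λ k → χ (punchIn i j) (punchIn i k)))
      ≡⟨ sum-cong-≗ (λ j → cong₂ _+_
           (ind-⇔ (crossing? σ (punchIn i j , i)) (left? j) (crossing-into-i j) (left-crosses-i j))
           (trans (sum-cong-≗ λ k → ind-⊎ (crossing? σ (punchIn i j , punchIn i k)) (crossing? τ (j , k)) (diag? j k)
                     (crossing-down j k) (crossing-up j k) (diag-crosses j k) (diag-disjoint j k))
                  (∑-distrib-+ (λ k → ind (crossing? τ (j , k))) (λ k → ind (diag? j k))))) ⟩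
    sum (λ j → ind (left? j) + (C j + D j))
      ≡⟨ trans (∑-distrib-+ (λ j → ind (left? j)) (λ j → C j + D j)) (cong (sum (λ j → ind (left? j)) +_) (∑-distrib-+ C D)) ⟩
    sum (λ j → ind (left? j)) + (sum C + sum D)
      ≡⟨ cong₂ (λ c d → sum (λ j → ind (left? j)) + (c + d)) (sym (crs≡sum τ))
               (trans (∑-comm (λ j k → ind (diag? j k))) (sum-cong-≗ sum-diag)) ⟩
    sum (λ j → ind (left? j)) + (crs τ + sum (λ k → ind (right? k)))
      ≡⟨ trans (cong (sum (λ j → ind (left? j)) +_) (ℕP.+-comm (crs τ) _))
               (sym (ℕP.+-assoc (sum (λ j → ind (left? j))) _ (crs τ))) ⟩
    sum (λ j → ind (left? j)) + sum (λ k → ind (right? k)) + crs τ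
      ≡⟨ cong (_+ crs τ) (∑-distrib-+ (λ j → ind (left? j)) (λ k → ind (right? k))) ⟨
    sum (λ k → ind (left? k) + ind (right? k)) + crs τ
      ≡⟨ cong (_+ crs τ) (sum-cong-≗ λ k → ind-⊎ (fresh? k) (left? k) (right? k)
           (λ f → [ (λ k<i → inj₁ (k<i , f)) , (λ i≤k → inj₂ (i≤k , f)) ]′ (ℕP.<-≤-connex (toℕ k) (toℕ i)))
           proj₂ proj₂ (λ ((k<i , _) , (i≤k , _)) → ℕP.<⇒≱ k<i i≤k)) ⟨
    sum (λ k → ind (fresh? k)) + crs τ
      ≡⟨ cong (_+ crs τ) (sum-permute (λ y → ind (between? (toℕ i) (toℕ v) (toℕ y))) (toPermutation {σ = τ} perm)) ⟨
    sum {n} (λ y → ind (between? (toℕ i) (toℕ v) (toℕ y))) + crs τ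
      ≡⟨ cong (_+ crs τ) (sum-between n (toℕ i) (toℕ v) (FP.toℕ≤pred[n] v)) ⟩
    (toℕ v ∸ suc (toℕ i)) + crs τ ∎
    where
    open ≡-Reasoning
    χ : Fin (suc n) → Fin (suc n) → ℕ
    χ r s = ind (crossing? σ (r , s))
    C D : Fin n → ℕ
    C j = sum (λ k → ind (crossing? τ (j , k)))
    D j = sum (λ k → ind (diag? j k))

-- Duplicate-free lists of avoiders.

unique-↭ : ∀ {A : Set} {xs ys : List A} → Unique xs → Unique ys →
           (∀ {x} → x ∈ xs → x ∈ ys) → (∀ {x} → x ∈ ys → x ∈ xs) → xs ↭ ys
unique-↭ uxs uys f g = ∼bag⇒↭ (unique∧set⇒bag uxs uys (mk⇔ f g))

∈-allWords : ∀ {k n} (w : Vec (Fin n) k) → w ∈ allWords k n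
∈-allWords []      = here refl
∈-allWords (a ∷ w) = ∈-concatMap⁺ _ (Any.map (λ { refl → ∈-map⁺ _ (∈-allFin a) }) (∈-allWords w))

allWords-unique : ∀ k n → Unique (allWords k n)
allWords-unique zero    n = [] ∷ []
allWords-unique (suc k) n = AllPairsP.concat⁺
  (AllP.map⁺ (All.universal (λ w → Unique.map⁺ VecP.∷-injectiveˡ (Unique.allFin⁺ n)) _))
  (AllPairsP.map⁺ (AllPairs.map
    (λ w≢w′ → AllP.map⁺ (All.universal (λ a → AllP.map⁺ (All.universal (λ b → w≢w′ ∘ VecP.∷-injectiveʳ) _)) _))
    (allWords-unique k n)))

module _ (pat : Vec ℕ 3) where

  ∈-avoiders⁺ : {σ : Vec (Fin n) n} → IsPerm σ → Avoids pat σ → σ ∈ avoiders n pat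
  ∈-avoiders⁺ perm av = ∈-filter⁺ (avoids? pat) (∈-filter⁺ isPerm? (∈-allWords _) perm) av

  ∈-avoiders⁻ : {σ : Vec (Fin n) n} → σ ∈ avoiders n pat → IsPerm σ × Avoids pat σ
  ∈-avoiders⁻ {n = n} σ∈ with σ∈perms , av ← ∈-filter⁻ (avoids? pat) {xs = perms n} σ∈ =
    proj₂ (∈-filter⁻ isPerm? {xs = allWords n n} σ∈perms) , av

  avoiders-unique : ∀ n → Unique (avoiders n pat)
  avoiders-unique n = Unique.filter⁺ (avoids? pat) (Unique.filter⁺ isPerm? (allWords-unique n n))

-- The last weak excedance.

largest : ∀ {P : Fin n → Set} → Decidable P → ∃ P → ∃ λ i → P i × (∀ j → i Fin.< j → ¬ P j)
largest {suc n} P? (x , Px) with FP.any? (P? ∘ suc)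
... | yes above with i , Pi , max ← largest (P? ∘ suc) above =
  suc i , Pi , λ { (suc j) (s≤s i<j) → max j i<j }
... | no  none with x
...   | zero  = zero , Px , λ { (suc j) _ Pj → none (j , Pj) }
...   | suc y = contradiction (y , Px) none

record LastWeakExc (σ : Vec (Fin (suc n)) (suc n)) (i : Fin (suc n)) : Set where
  field
    weak : i Fin.≤ σ ! i
    last : ∀ r → i Fin.< r → σ ! r Fin.< r

lastWeakExc : (σ : Vec (Fin (suc n)) (suc n)) → ∃ (LastWeakExc σ)
-- Row 0 is always a weak excedance, so there is a last one.
lastWeakExc σ with i , weak , max ← largest (λ r → r Fin.≤? σ ! r) (zero , z≤n) =
  i , record { weak = weak ; last = λ r i<r → ℕP.≰⇒> (max r i<r) }

lastWeakExc-unique : ∀ {σ} {i j : Fin (suc n)} → LastWeakExc σ i → LastWeakExc σ j → i ≡ j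
lastWeakExc-unique {i = i} {j} wi wj with FP.<-cmp i j
... | tri≈ _ i≡j _ = i≡j
... | tri< i<j _ _ = contradiction (LastWeakExc.weak wj) (ℕP.<⇒≱ (LastWeakExc.last wi j i<j))
... | tri> _ _ j<i = contradiction (LastWeakExc.weak wi) (ℕP.<⇒≱ (LastWeakExc.last wj i j<i))

ins-avoids⁻ : ∀ pat {τ : Vec (Fin n) n} {i v} → Avoids pat (ins i v τ) → Avoids pat τ
ins-avoids⁻ (a ∷ b ∷ c ∷ []) {τ} {i} {v} av (j , k , l , j<k , k<l , ab , ac , bc) =
  av (punchIn i j , punchIn i k , punchIn i l , punchIn-mono-< i j k j<k , punchIn-mono-< i k l k<l ,
      lift ab , lift ac , lift bc)
  where
  mono : ∀ r s → τ ! r Fin.< τ ! s → ins i v τ ! punchIn i r Fin.< ins i v τ ! punchIn i s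
  mono r s lt = subst₂ Fin._<_ (sym (ins-there i v τ r)) (sym (ins-there i v τ s)) (punchIn-mono-< v _ _ lt)
  lift : ∀ {x y r s} → SameOrder x y (toℕ (τ ! r)) (toℕ (τ ! s)) →
         SameOrder x y (toℕ (ins i v τ ! punchIn i r)) (toℕ (ins i v τ ! punchIn i s))
  lift {r = r} {s} (lt , gt) = mono r s ∘ lt , mono s r ∘ gt

-- Generating trees

-- Gap τ i v is meant to say that inserting the value v at row i keeps the pattern avoided and
-- makes the new point the last weak excedance.
module Gaps (Gap : ∀ {n} → Vec (Fin n) n → Fin (suc n) → Fin (suc n) → Set) where

  HasGap : Vec (Fin n) n → ℕ → Set
  HasGap τ e = ∃[ i ] ∃[ v ] Gap τ i v × toℕ v ≡ toℕ i + e

  State : Vec (Fin n) n → ℕ → Set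
  State τ a = ∀ e → (e ℕ.≤ a → HasGap τ e) × (HasGap τ e → e ℕ.≤ a)

-- This isolates what has to be proved separately for 213 and 321. `ins-avoids` and `gap-del` say
-- that gaps are the right insertions, `gap-unique` that a letter determines the inserted point, and
-- the `state` fields are the transitions of the word encoding.
record Scheme (pat : Vec ℕ 3) : Set₁ where
  field
    Gap        : ∀ {n} → Vec (Fin n) n → Fin (suc n) → Fin (suc n) → Set
  open Gaps Gap public
  field
    insertable : ∀ {n} {τ : Vec (Fin n) n} {i v} → Gap τ i v → Insertable τ i v
    ins-avoids : ∀ {n} {τ : Vec (Fin n) n} {i v} → Gap τ i v → Avoids pat τ → Avoids pat (ins i v τ)
    gap-del    : ∀ {n} {τ : Vec (Fin n) n} {i v} → IsPerm (ins i v τ) → Avoids pat (ins i v τ) →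
                 LastWeakExc (ins i v τ) i → Gap τ i v
    gap-[]     : Gap [] zero zero
    gap-unique : ∀ {n} {τ : Vec (Fin n) n} {i v i′ v′ e} → IsPerm τ → Gap τ i v → Gap τ i′ v′ →
                 toℕ v ≡ toℕ i + e → toℕ v′ ≡ toℕ i′ + e → i ≡ i′
    state-exc : ∀ {n} {τ : Vec (Fin n) n} {i v d} → IsPerm τ → Avoids pat τ → Gap τ i v →
                toℕ v ≡ toℕ i + suc d → State (ins i v τ) (suc d)
    state-fix : ∀ {n} {τ : Vec (Fin n) n} {i v a} → IsPerm τ → Avoids pat τ → Gap τ i v →
                toℕ v ≡ toℕ i + 0 → State τ a → State (ins i v τ) (suc a)

module Enumeration {pat : Vec ℕ 3} (S : Scheme pat) where
  open Scheme S

  record Node (n : ℕ) : Set where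
    field
      word    : Vec (Fin n) n
      state    : ℕ
      perm    : IsPerm word
      avoids  : Avoids pat word
      isState : State word state
  open Node

  root : Node 0
  root = record
    { word = [] ; state = 0 ; perm = λ () ; avoids = λ ()
    ; isState = λ e → (λ { z≤n → zero , zero , gap-[] , refl }) , λ { (zero , zero , _ , 0≡e) → ℕP.≤-reflexive (sym 0≡e) }
    }

  ins-lastWeakExc : ∀ {τ : Vec (Fin n) n} {i v} → Gap τ i v → LastWeakExc (ins i v τ) i
  ins-lastWeakExc {τ = τ} {i} {v} gap = record
    { weak = subst (i Fin.≤_) (sym (ins-here i v τ)) (Insertable.weakExc (insertable gap))
    ; last = InsertStats.σ-below-diagonal (insertable gap)
    }

  grow : ℕ → ℕ → ℕ
  grow a zero    = suc a
  grow a (suc d) = suc d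

  state-grow : ∀ {τ : Vec (Fin n) n} {i v a} e → IsPerm τ → Avoids pat τ → Gap τ i v →
               toℕ v ≡ toℕ i + e → State τ a → State (ins i v τ) (grow a e)
  state-grow zero    pm av gap eq st = state-fix pm av gap eq st
  state-grow (suc d) pm av gap eq st = state-exc pm av gap eq

  module Child (x : Node n) (e : Fin (suc (state x))) where
    hasGap : HasGap (word x) (toℕ e)
    hasGap = proj₁ (isState x (toℕ e)) (FP.toℕ≤pred[n] e)

    i v : Fin (suc n)
    i = proj₁ hasGap
    v = proj₁ (proj₂ hasGap)

    gap : Gap (word x) i v
    gap = proj₁ (proj₂ (proj₂ hasGap))

    offset : toℕ v ≡ toℕ i + toℕ e
    offset = proj₂ (proj₂ (proj₂ hasGap))

    child : Node (suc n)
    child = record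
      { word    = ins i v (word x)
      ; state    = grow (state x) (toℕ e)
      ; perm    = ins-perm i v (perm x)
      ; avoids  = ins-avoids gap (avoids x)
      ; isState = state-grow (toℕ e) (perm x) (avoids x) gap offset (isState x)
      }
  open Child using (child)

  children : Node n → List (Node (suc n))
  children x = tabulate (child x)

  level : ∀ n → List (Node n)
  level zero    = root ∷ []
  level (suc n) = concatMap children (level n)

  -- The inserted row is recovered from the child as its last weak excedance, and the inserted value
  -- is the entry there; cancelling the insertion returns the parent.
  child-injective : (x y : Node n) (e : Fin (suc (state x))) (f : Fin (suc (state y))) →
                    word (child x e) ≡ word (child y f) → word x ≡ word y × toℕ e ≡ toℕ f
  child-injective x y e f eq = same-word , same-offset
    where
    module X = Child x e
    module Y = Child y f
    same-i : X.i ≡ Y.i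
    same-i = lastWeakExc-unique (ins-lastWeakExc X.gap)
      (subst (λ σ → LastWeakExc σ Y.i) (sym eq) (ins-lastWeakExc Y.gap))
    same-v : X.v ≡ Y.v
    same-v = trans (sym (ins-here X.i X.v (word x)))
      (trans (cong₂ _!_ eq same-i) (ins-here Y.i Y.v (word y)))
    same-word : word x ≡ word y
    same-word = ins-injective X.i X.v (trans eq (sym (cong₂ (λ i v → ins i v (word y)) same-i same-v)))
    same-offset : toℕ e ≡ toℕ f
    same-offset = ℕP.+-cancelˡ-≡ (toℕ X.i) _ _
      (trans (sym X.offset) (trans (cong toℕ same-v) (trans Y.offset (cong (λ i → toℕ i + toℕ f) (sym same-i)))))

  -- Siblings differ in their letter, and children of different parents differ because the parents
  -- can be recovered. The claim is about words, since these are what is compared with the list of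
  -- avoiders.
  level-distinct : ∀ n → AllPairs (λ x y → word x ≢ word y) (level n)
  level-distinct zero    = [] ∷ []
  level-distinct (suc n) = AllPairsP.concat⁺
    (AllP.map⁺ (All.universal (λ x → AllPairsP.tabulate⁺ {f = child x} λ {e} {f} e≢f eq →
      e≢f (FP.toℕ-injective (proj₂ (child-injective x x e f eq)))) _))
    (AllPairsP.map⁺ (AllPairs.map
      (λ {x} {y} x≢y → AllP.tabulate⁺ {f = child x} λ e → AllP.tabulate⁺ {f = child y} λ f → x≢y ∘ proj₁ ∘ child-injective x y e f)
      (level-distinct n)))

  level-complete : {σ : Vec (Fin n) n} → IsPerm σ → Avoids pat σ → ∃[ x ] x ∈ level n × word x ≡ σ
  level-complete {zero}  {[]} pm av = root , here refl , refl
  level-complete {suc n} {σ}  pm av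
    with i , last ← lastWeakExc σ
    with v , τ , refl ← del {σ = σ} pm i
    with x , x∈ , refl ← level-complete (ins-perm⁻ i _ pm) (ins-avoids⁻ pat av)
    = child x e , ∈-concatMap⁺ children (Any.map (λ { refl → ∈-tabulate⁺ {f = child x} e }) x∈) ,
      cong₂ (λ i v → ins i v (word x)) same-i same-v
    where
    gap : Gap (word x) i v
    gap = gap-del pm av last
    offset : toℕ v ≡ toℕ i + (toℕ v ∸ toℕ i)
    offset = sym (ℕP.m+[n∸m]≡n (Insertable.weakExc (insertable gap)))
    fits : toℕ v ∸ toℕ i ℕ.< suc (state x)
    fits = s≤s (proj₂ (isState x _) (i , v , gap , offset))
    e = Fin.fromℕ< fits
    module X = Child x e
    offset′ : toℕ X.v ≡ toℕ X.i + (toℕ v ∸ toℕ i)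
    offset′ = trans X.offset (cong (toℕ X.i +_) (FP.toℕ-fromℕ< fits))
    -- `child` inserts at the gap that `isState` supplies for this offset; uniqueness identifies it
    -- with the point that was deleted.
    same-i : X.i ≡ i
    same-i = gap-unique (perm x) X.gap gap offset′ offset
    same-v : X.v ≡ v
    same-v = FP.toℕ-injective (trans offset′ (trans (cong (λ i → toℕ i + _) same-i) (sym offset)))

  level↭avoiders : ∀ n → map word (level n) ↭ avoiders n pat
  level↭avoiders n = unique-↭ (AllPairsP.map⁺ (level-distinct n)) (avoiders-unique pat n)
    (λ σ∈ → let x , _ , σ≡ = ∈-map⁻ word σ∈ in
      subst (_∈ avoiders n pat) (sym σ≡) (∈-avoiders⁺ pat (perm x) (avoids x)))
    (λ σ∈ → let pm , av = ∈-avoiders⁻ pat σ∈ ; x , x∈ , x≡σ = level-complete pm av in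
      subst (_∈ map word (level n)) x≡σ (∈-map⁺ word x∈))

  exc-child-fix : (x : Node n) → exc (word (child x zero)) ≡ exc (word x)
  exc-child-fix x = trans (InsertStats.exc-ins (insertable X.gap))
    (cong (_+ exc (word x)) (ind-no (X.i Fin.<? X.v) (ℕP.≤⇒≯ (ℕP.≤-reflexive (trans X.offset (ℕP.+-identityʳ _))))))
    where module X = Child x zero

  crs-child-fix : (x : Node n) → crs (word (child x zero)) ≡ crs (word x)
  crs-child-fix x = trans (InsertStats.crs-ins (insertable X.gap) (perm x))
    (cong (_+ crs (word x)) (ℕP.m≤n⇒m∸n≡0 (ℕP.m≤n⇒m≤1+n (ℕP.≤-reflexive (trans X.offset (ℕP.+-identityʳ _))))))
    where module X = Child x zero

  exc-child-exc : (x : Node n) (d : Fin (state x)) → exc (word (child x (suc d))) ≡ suc (exc (word x))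
  exc-child-exc x d = trans (InsertStats.exc-ins (insertable X.gap))
    (cong (_+ exc (word x)) (ind-yes (X.i Fin.<? X.v)
      (subst (toℕ X.i ℕ.<_) (sym X.offset) (ℕP.m<m+n (toℕ X.i) (s≤s z≤n)))))
    where module X = Child x (suc d)

  crs-child-exc : (x : Node n) (d : Fin (state x)) → crs (word (child x (suc d))) ≡ toℕ d + crs (word x)
  crs-child-exc x d = trans (InsertStats.crs-ins (insertable X.gap) (perm x))
    (cong (_+ crs (word x)) (trans (cong (_∸ suc (toℕ X.i)) (trans X.offset (ℕP.+-suc (toℕ X.i) (toℕ d))))
                                   (ℕP.m+n∸m≡n (toℕ X.i) (toℕ d))))
    where module X = Child x (suc d)

-- Generating functions of the tree levels.

module GF {c ℓ : Level} (R : CommutativeSemiring c ℓ) (q p : CommutativeSemiring.Carrier R) where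
  open CommutativeSemiring R hiding (zero) renaming (_+_ to _⊕_; refl to ≈-refl; sym to ≈-sym; trans to ≈-trans)
  open import Algebra.Definitions.RawSemiring rawSemiring using (_^_)
  open import Algebra.Properties.Semiring.Exp semiring using (^-homo-*)
  open import Algebra.Solver.Ring.NaturalCoefficients.Default R using (solve; _:=_; _:+_; _:*_)
  open import Relation.Binary.Reasoning.Setoid setoid
  open CatalanTree R q p

  weight : Vec (Fin n) n → Carrier
  weight σ = q ^ exc σ * p ^ crs σ

  sumR-↭ : ∀ {A : Set} (g : A → Carrier) {xs ys} → xs ↭ ys → sumR R (map g xs) ≈ sumR R (map g ys)
  sumR-↭ g Perm↭.refl          = ≈-refl
  sumR-↭ g (Perm↭.prep x r)    = +-congˡ (sumR-↭ g r)
  sumR-↭ g (Perm↭.swap x y r)  = ≈-trans (+-congˡ (+-congˡ (sumR-↭ g r)))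
    (solve 3 (λ a b s → a :+ (b :+ s) := b :+ (a :+ s)) ≈-refl _ _ _)
  sumR-↭ g (Perm↭.trans r s)   = ≈-trans (sumR-↭ g r) (sumR-↭ g s)

  sumR-++ : ∀ xs ys → sumR R (xs ++ ys) ≈ sumR R xs ⊕ sumR R ys
  sumR-++ []       ys = ≈-sym (+-identityˡ _)
  sumR-++ (x ∷ xs) ys = ≈-trans (+-congˡ (sumR-++ xs ys)) (≈-sym (+-assoc _ _ _))

  sumR-concatMap : ∀ {A B : Set} (f : A → List B) (g : B → Carrier) {h : A → Carrier} →
                   (∀ x → sumR R (map g (f x)) ≈ h x) → ∀ xs →
                   sumR R (map g (concatMap f xs)) ≈ sumR R (map h xs)
  sumR-concatMap f g gf≈h []       = ≈-refl
  sumR-concatMap f g {h} gf≈h (x ∷ xs) = begin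
    sumR R (map g (f x ++ concatMap f xs))
      ≡⟨ cong (sumR R) (List.map-++ g (f x) (concatMap f xs)) ⟩
    sumR R (map g (f x) ++ map g (concatMap f xs))
      ≈⟨ sumR-++ (map g (f x)) _ ⟩
    sumR R (map g (f x)) ⊕ sumR R (map g (concatMap f xs))
      ≈⟨ +-cong (gf≈h x) (sumR-concatMap f g gf≈h xs) ⟩
    h x ⊕ sumR R (map h xs) ∎

  sumR-tabulate : ∀ {A : Set} (g : A → Carrier) (h : ℕ → Carrier) {m} (f : Fin m → A) →
                  (∀ i → g (f i) ≈ h (toℕ i)) → sumR R (map g (tabulate f)) ≈ ∑ m h
  sumR-tabulate g h {zero}  f gf≈h = ≈-refl
  sumR-tabulate g h {suc m} f gf≈h = +-cong (gf≈h zero) (sumR-tabulate g (h ∘ suc) (f ∘ suc) (gf≈h ∘ suc))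

  module _ {pat : Vec ℕ 3} (S : Scheme pat) where
    open Enumeration S
    open Node
    open Child using (child)

    weight-fix : (x : Node n) → weight (word (child x zero)) ≈ weight (word x)
    weight-fix x = reflexive (cong₂ (λ e c → q ^ e * p ^ c) (exc-child-fix x) (crs-child-fix x))

    weight-exc : (x : Node n) (d : Fin (state x)) →
                 weight (word (child x (suc d))) ≈ weight (word x) * (q * p ^ toℕ d)
    weight-exc x d = begin
      weight (word (child x (suc d)))
        ≡⟨ cong₂ (λ e c → q ^ e * p ^ c) (exc-child-exc x d) (crs-child-exc x d) ⟩
      q * q ^ exc (word x) * p ^ (toℕ d + crs (word x))
        ≈⟨ *-congˡ (^-homo-* p (toℕ d) (crs (word x))) ⟩
      q * q ^ exc (word x) * (p ^ toℕ d * p ^ crs (word x))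
        ≈⟨ solve 4 (λ q e d c → q :* e :* (d :* c) := (e :* c) :* (q :* d)) ≈-refl q _ _ _ ⟩
      weight (word x) * (q * p ^ toℕ d) ∎

    children-sum : ∀ m (x : Node n) → sumR R (map (λ y → weight (word y) * F m (state y)) (children x)) ≈
                                      weight (word x) * F (suc m) (state x)
    children-sum m x = begin
      weight (word (child x zero)) * F m (suc (state x)) ⊕
        sumR R (map (λ y → weight (word y) * F m (state y)) (tabulate (child x ∘ suc)))
        ≈⟨ +-cong (*-congʳ (weight-fix x))
             (sumR-tabulate _ (λ d → (w * q) * (p ^ d * F m (suc d))) (child x ∘ suc) (λ d →
               ≈-trans (*-congʳ (weight-exc x d))
                 (solve 4 (λ w q d f → (w :* (q :* d)) :* f := (w :* q) :* (d :* f)) ≈-refl w q _ _))) ⟩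
      w * F m (suc (state x)) ⊕ ∑ (state x) (λ d → (w * q) * (p ^ d * F m (suc d)))
        ≈⟨ +-congˡ (*-distribˡ-∑ (state x) (w * q) _) ⟨
      w * F m (suc (state x)) ⊕ w * q * s
        ≈⟨ solve 4 (λ w q f s → w :* f :+ w :* q :* s := w :* (f :+ q :* s)) ≈-refl w q _ s ⟩
      w * F (suc m) (state x) ∎
      where
      w = weight (word x)
      s = ∑ (state x) (λ d → p ^ d * F m (suc d))

    -- Each summand is the total weight of the descendants m generations below a node, so going up
    -- one level while raising m by one leaves the sum unchanged. The case m = 0 is the one wanted;
    -- the induction needs all m.
    level-sum : ∀ n m → sumR R (map (λ x → weight (word x) * F m (state x)) (level n)) ≈ F (n + m) 0
    level-sum zero    m = begin
      (1# * 1#) * F m 0 ⊕ 0#  ≈⟨ +-identityʳ _ ⟩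
      (1# * 1#) * F m 0       ≈⟨ *-congʳ (*-identityˡ 1#) ⟩
      1# * F m 0              ≈⟨ *-identityˡ _ ⟩
      F m 0                   ∎
    level-sum (suc n) m = begin
      sumR R (map (λ x → weight (word x) * F m (state x)) (concatMap children (level n)))
        ≈⟨ sumR-concatMap children _ (children-sum m) (level n) ⟩
      sumR R (map (λ x → weight (word x) * F (suc m) (state x)) (level n))
        ≈⟨ level-sum n (suc m) ⟩
      F (n + suc m) 0
        ≡⟨ cong (λ k → F k 0) (ℕP.+-suc n m) ⟩
      F (suc n + m) 0 ∎

    nodes-sum : ∀ n → sumR R (map (weight ∘ word) (level n)) ≈ qpCatalan R n q p
    nodes-sum n = begin
      sumR R (map (weight ∘ word) (level n))
        ≈⟨ times-one (level n) ⟩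
      sumR R (map (λ x → weight (word x) * F 0 (state x)) (level n))
        ≈⟨ level-sum n 0 ⟩
      F (n + 0) 0
        ≡⟨ cong (λ k → F k 0) (ℕP.+-identityʳ n) ⟩
      F n 0
        ≈⟨ catF≈F n n ℕP.≤-refl ⟨
      qpCatalan R n q p ∎
      where
      times-one : (xs : List (Node n)) →
                  sumR R (map (weight ∘ word) xs) ≈ sumR R (map (λ x → weight (word x) * 1#) xs)
      times-one []       = ≈-refl
      times-one (x ∷ xs) = +-cong (≈-sym (*-identityʳ _)) (times-one xs)

    -- The map `f` allows the tree of one pattern to count the avoiders of another: it is `word` for
    -- 213 and 321, and the reflection for 132.
    gf≈catalan : ∀ pat′ (f : ∀ {n} → Node n → Vec (Fin n) n) →
                 (∀ {n} (x : Node n) → exc (f x) ≡ exc (word x) × crs (f x) ≡ crs (word x)) →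
                 (∀ n → map f (level n) ↭ avoiders n pat′) →
                 ∀ n → excCrsGF R n pat′ q p ≈ qpCatalan R n q p
    gf≈catalan pat′ f stats f↭ n = begin
      sumR R (map weight (avoiders n pat′))
        ≈⟨ sumR-↭ weight (f↭ n) ⟨
      sumR R (map weight (map f (level n)))
        ≡⟨ cong (sumR R) (List.map-∘ (level n)) ⟨
      sumR R (map (weight ∘ f) (level n))
        ≡⟨ cong (sumR R) (List.map-cong (λ x → let e , c = stats x in cong₂ (λ e c → q ^ e * p ^ c) e c) (level n)) ⟩
      sumR R (map (weight ∘ word) (level n))
        ≈⟨ nodes-sum n ⟩
      qpCatalan R n q p ∎

-- The patterns 321 and 213

module _ (σ : Vec (Fin n) n) {i j k : Fin n} where

  pattern213 : i Fin.< j → j Fin.< k → σ ! j Fin.< σ ! i → σ ! i Fin.< σ ! k → Contains pat213 σ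
  pattern213 i<j j<k σj<σi σi<σk = i , j , k , i<j , j<k ,
    ((λ { (s≤s ()) }) , λ _ → σj<σi) ,
    ((λ _ → σi<σk) , λ { (s≤s (s≤s ())) }) ,
    ((λ _ → ℕP.<-trans σj<σi σi<σk) , λ { (s≤s ()) })

  pattern321 : i Fin.< j → j Fin.< k → σ ! k Fin.< σ ! j → σ ! j Fin.< σ ! i → Contains pat321 σ
  pattern321 i<j j<k σk<σj σj<σi = i , j , k , i<j , j<k ,
    ((λ { (s≤s (s≤s ())) }) , λ _ → σj<σi) ,
    ((λ { (s≤s ()) }) , λ _ → ℕP.<-trans σk<σj σj<σi) ,
    ((λ { (s≤s ()) }) , λ _ → σk<σj)

1<2 : 1 ℕ.< 2
1<2 = s≤s (s≤s z≤n)

2<3 : 2 ℕ.< 3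
2<3 = s≤s (s≤s (s≤s z≤n))

value : (τ : Vec (Fin n) n) → IsPerm τ → ∀ {m} → m ℕ.< n → ∃ λ r → toℕ (τ ! r) ≡ m
value τ perm m<n with r , eq ← preimage {σ = τ} perm (fromℕ< m<n) = r , trans (cong toℕ eq) (FP.toℕ-fromℕ< m<n)

≤∧≢⇒< : (τ : Vec (Fin n) n) → IsPerm τ → ∀ {r s} → r ≢ s → τ ! r Fin.≤ τ ! s → τ ! r Fin.< τ ! s
≤∧≢⇒< τ perm r≢s le = ℕP.≤∧≢⇒< le (r≢s ∘ perm _ _ ∘ FP.toℕ-injective)

module _ (i v : Fin (suc n)) (τ : Vec (Fin n) n) where

  ins-mono : ∀ {j k} → τ ! j Fin.< τ ! k → ins i v τ ! punchIn i j Fin.< ins i v τ ! punchIn i k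
  ins-mono lt = subst₂ Fin._<_ (sym (ins-there i v τ _)) (sym (ins-there i v τ _)) (punchIn-mono-< v _ _ lt)

  ins-cancel : ∀ {j k} → ins i v τ ! punchIn i j Fin.< ins i v τ ! punchIn i k → τ ! j Fin.< τ ! k
  ins-cancel lt = punchIn-cancel-< v _ _ (subst₂ Fin._<_ (ins-there i v τ _) (ins-there i v τ _) lt)

module _ {τ : Vec (Fin n) n} {i v : Fin (suc n)} where

  last-weak : LastWeakExc (ins i v τ) i → i Fin.≤ v
  last-weak last = subst (i Fin.≤_) (ins-here i v τ) (LastWeakExc.weak last)

  last-low : LastWeakExc (ins i v τ) i → ∀ r → i Fin.≤ r → τ ! r Fin.≤ r
  last-low last r i≤r = ℕ.s≤s⁻¹ (ℕP.≤-<-trans (≤-punchIn v (τ ! r) ℕP.≤-refl)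
    (subst₂ ℕ._<_ (cong toℕ (ins-there i v τ r)) (punchIn-above i r i≤r)
                  (LastWeakExc.last last (punchIn i r) (<-punchIn i r i≤r))))

-- Row i + 1 is no weak excedance, so its value is at most i and thus less than that of row i. This
-- descent is what completes the forbidden patterns in both `gap-del` proofs.
next-row : {σ : Vec (Fin (suc n)) (suc n)} → IsPerm σ → ∀ {i} → LastWeakExc σ i → toℕ i ℕ.< n →
           ∃ λ s → toℕ s ≡ suc (toℕ i) × σ ! s Fin.< σ ! i
next-row {σ = σ} perm {i} last i<n = s , s≡ , ≤∧≢⇒< σ perm (λ s≡i → ℕP.1+n≢n (trans (sym s≡) (cong toℕ s≡i)))
  (ℕP.≤-trans (ℕ.s≤s⁻¹ (subst (toℕ (σ ! s) ℕ.<_) s≡ (LastWeakExc.last last s i<s))) (LastWeakExc.weak last))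
  where
  s = fromℕ< (s≤s i<n)
  s≡ = FP.toℕ-fromℕ< (s≤s i<n)
  i<s : i Fin.< s
  i<s = ℕP.≤-reflexive (sym s≡)

-- Avoiders of 321.

module Pattern321 where

  -- In a 321-avoider on the rows 0, ..., n the last weak excedance i carries the largest value n.
  -- That value cannot lie behind i; if it lay before i < n, it would form a 321 with the rows i and
  -- i + 1; and i = n forces v = n. A gap is thus given by its row alone, and no descent may follow
  -- it.
  record Gap {n} (τ : Vec (Fin n) n) (i v : Fin (suc n)) : Set where
    field
      max        : toℕ v ≡ n
      increasing : ∀ r s → i Fin.≤ r → r Fin.< s → τ ! r Fin.< τ ! s

  open Gap
  open Gaps Gap

  -- Going up from the last row, the value in row r is less than that in row r + 1, hence at most r.
  -- The recursion runs on the number k of rows behind r.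
  low : {τ : Vec (Fin n) n} {i v : Fin (suc n)} → Gap τ i v → ∀ r → i Fin.≤ r → τ ! r Fin.≤ r
  low {n} {τ} {i} gap r = go (n ∸ suc (toℕ r)) r (sym (ℕP.m+[n∸m]≡n (FP.toℕ<n r)))
    where
    go : ∀ k r → n ≡ suc (toℕ r) + k → i Fin.≤ r → τ ! r Fin.≤ r
    go zero    r eq i≤r = ℕ.s≤s⁻¹ (subst (toℕ (τ ! r) ℕ.<_) (trans eq (ℕP.+-identityʳ _)) (FP.toℕ<n (τ ! r)))
    go (suc k) r eq i≤r = ℕ.s≤s⁻¹ (ℕP.<-≤-trans (increasing gap r s i≤r r<s)
      (subst (toℕ (τ ! s) ℕ.≤_) s≡ (go k s (trans eq (trans (ℕP.+-suc _ k) (cong (λ m → suc m + k) (sym s≡))))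
                                        (ℕP.≤-trans i≤r (ℕP.<⇒≤ r<s)))))
      where
      1+r<n : suc (toℕ r) ℕ.< n
      1+r<n = subst (suc (toℕ r) ℕ.<_) (sym eq) (ℕP.m<m+n (suc (toℕ r)) (s≤s z≤n))
      s = fromℕ< 1+r<n
      s≡ = FP.toℕ-fromℕ< 1+r<n
      r<s : r Fin.< s
      r<s = ℕP.≤-reflexive (sym s≡)

  insertable : {τ : Vec (Fin n) n} {i v : Fin (suc n)} → Gap τ i v → Insertable τ i v
  insertable {τ = τ} {i} gap = record
    { weakExc = subst (toℕ i ℕ.≤_) (sym (max gap)) (FP.toℕ≤pred[n] i)
    ; top     = λ r _ → subst (toℕ (τ ! r) ℕ.<_) (sym (max gap)) (FP.toℕ<n (τ ! r))
    ; low     = low gap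
    }

  module _ {τ : Vec (Fin n) n} {i v : Fin (suc n)} (gap : Gap τ i v) where
    private σ = ins i v τ

    σ≤v : ∀ r → σ ! r Fin.≤ v
    σ≤v r = subst (toℕ (σ ! r) ℕ.≤_) (sym (max gap)) (FP.toℕ≤pred[n] (σ ! r))

    σ≤σi : ∀ r → σ ! r Fin.≤ σ ! i
    σ≤σi r = subst (σ ! r Fin.≤_) (sym (ins-here i v τ)) (σ≤v r)

    σ-increasing : ∀ r s → i Fin.< r → r Fin.< s → σ ! r Fin.< σ ! s
    σ-increasing r s i<r r<s with row i r | row i s
    ... | here    | _       = contradiction i<r (ℕP.<-irrefl refl)
    ... | there j | here    = contradiction r<s (ℕP.<-asym i<r)
    ... | there j | there k = ins-mono i v τ (increasing gap j k (punchIn-above⁻ i j i<r) (punchIn-cancel-< i j k r<s))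

    -- The new value is the largest, so it could only serve as the 3, but the rows behind it
    -- increase.
    ins-avoids : Avoids pat321 τ → Avoids pat321 σ
    ins-avoids av (r , s , t , r<s , s<t , rs , rt , st) with row i r | row i s | row i t
    ... | here | _ | _ = ℕP.<-asym (proj₂ st 1<2) (σ-increasing _ _ r<s s<t)
    ... | there j | here | _ = ℕP.<⇒≱ (proj₂ rs 2<3) (σ≤σi _)
    ... | there j | there k | here = ℕP.<⇒≱ (proj₂ st 1<2) (σ≤σi _)
    ... | there j | there k | there l = av (pattern321 τ (punchIn-cancel-< i j k r<s) (punchIn-cancel-< i k l s<t)
                                               (ins-cancel i v τ (proj₂ st 1<2)) (ins-cancel i v τ (proj₂ rs 2<3)))

  gap-del : {τ : Vec (Fin n) n} {i v : Fin (suc n)} → IsPerm (ins i v τ) → Avoids pat321 (ins i v τ) →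
            LastWeakExc (ins i v τ) i → Gap τ i v
  gap-del {n} {τ} {i} {v} perm av last = record { max = v≡n ; increasing = inc }
    where
    σ = ins i v τ
    v≡n : toℕ v ≡ n
    v≡n with m , σm≡n ← value σ perm (ℕP.n<1+n n) with FP.<-cmp m i
    ... | tri≈ _ refl _ = trans (cong toℕ (sym (ins-here i v τ))) σm≡n
    ... | tri> _ _ i<m  = contradiction (subst (ℕ._< toℕ m) σm≡n (LastWeakExc.last last m i<m)) (ℕP.≤⇒≯ (FP.toℕ≤pred[n] m))
    ... | tri< m<i m≢i _ with ℕP.m≤n⇒m<n∨m≡n (FP.toℕ≤pred[n] i)
    ...   | inj₁ i<n with s , s≡ , σs<σi ← next-row {σ = σ} perm last i<n =
      contradiction (pattern321 σ m<i (ℕP.≤-reflexive (sym s≡)) σs<σi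
        (≤∧≢⇒< σ perm (m≢i ∘ sym) (subst (toℕ (σ ! i) ℕ.≤_) (sym σm≡n) (FP.toℕ≤pred[n] (σ ! i))))) av
    ...   | inj₂ i≡n = ℕP.≤-antisym (FP.toℕ≤pred[n] v) (ℕP.≤-trans (ℕP.≤-reflexive (sym i≡n)) (last-weak last))
    inc : ∀ r s → i Fin.≤ r → r Fin.< s → τ ! r Fin.< τ ! s
    inc r s i≤r r<s = ℕP.≰⇒> λ τs≤τr → av (pattern321 (ins i v τ)
      (<-punchIn i r i≤r) (punchIn-mono-< i r s r<s)
      (ins-mono i v τ (≤∧≢⇒< τ (ins-perm⁻ i v perm) (λ { refl → ℕP.<-irrefl refl r<s }) τs≤τr))
      (subst₂ Fin._<_ (sym (ins-there i v τ r)) (sym (ins-here i v τ))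
        (punchIn-< v (τ ! r) (subst (toℕ (τ ! r) ℕ.<_) (sym v≡n) (FP.toℕ<n (τ ! r))))))

  gap-at : ∀ {τ : Vec (Fin n) n} x {e} → n ≡ x + e →
           (∀ r s → x ℕ.≤ toℕ r → r Fin.< s → τ ! r Fin.< τ ! s) →
           HasGap τ e
  gap-at {n} x {e} n≡x+e inc = fromℕ< x<1+n , Fin.fromℕ n ,
    record { max = FP.toℕ-fromℕ n ; increasing = λ r s → inc r s ∘ subst (ℕ._≤ toℕ r) x≡ } ,
    trans (FP.toℕ-fromℕ n) (trans n≡x+e (cong (_+ e) (sym x≡)))
    where
    x<1+n : x ℕ.< suc n
    x<1+n = s≤s (subst (x ℕ.≤_) (sym n≡x+e) (ℕP.m≤m+n x e))
    x≡ = FP.toℕ-fromℕ< x<1+n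

  scheme : Scheme pat321
  scheme = record
    { Gap        = Gap
    ; insertable = insertable
    ; ins-avoids = ins-avoids
    ; gap-del    = gap-del
    ; gap-[]     = record { max = refl ; increasing = λ () }
    ; gap-unique = λ {n} {τ} {i} {v} {i′} {v′} {e} _ gap gap′ v≡ v′≡ → FP.toℕ-injective
        (ℕP.+-cancelʳ-≡ e (toℕ i) (toℕ i′) (trans (sym v≡) (trans (max gap) (trans (sym (max gap′)) v′≡))))
    ; state-exc  = λ {n} {τ} {i} {v} {d} _ _ gap v≡ e → exc⁺ gap v≡ e , exc⁻ gap v≡ e
    ; state-fix  = λ {n} {τ} {i} {v} {a} _ _ gap v≡ st e → fix⁺ gap v≡ st e , fix⁻ gap v≡ st e
    }
    where
    module _ {n} {τ : Vec (Fin n) n} {i v : Fin (suc n)} (gap : Gap τ i v) where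
      σ = ins i v τ

      module _ {d} (v≡ : toℕ v ≡ toℕ i + suc d) where

        1+n≡ : suc n ≡ suc (toℕ i) + suc d
        1+n≡ = cong suc (trans (sym (max gap)) v≡)

        -- The rows behind the new maximum increase, so every position x > i, including the end, is
        -- a gap; its offset n + 1 - x ranges over 0, ..., d + 1.
        exc⁺ : ∀ e → e ℕ.≤ suc d → HasGap σ e
        exc⁺ e e≤ = gap-at (suc n ∸ e) (sym (ℕP.m∸n+n≡m e≤1+n)) λ r s x≤r r<s →
          σ-increasing gap r s (ℕP.≤-trans i<x x≤r) r<s
          where
          e≤1+n : e ℕ.≤ suc n
          e≤1+n = ℕP.≤-trans e≤ (subst (suc d ℕ.≤_) (sym 1+n≡) (ℕP.m≤n+m (suc d) (suc (toℕ i))))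
          i<x : toℕ i ℕ.< suc n ∸ e
          i<x = ℕP.m+n≤o⇒m≤o∸n (suc (toℕ i))
            (subst (suc (toℕ i) + e ℕ.≤_) (sym 1+n≡) (ℕP.+-monoʳ-≤ (suc (toℕ i)) e≤))

        i<n : toℕ i ℕ.< n
        i<n = subst (toℕ i ℕ.<_) (trans (sym v≡) (max gap)) (ℕP.m<m+n (toℕ i) (s≤s z≤n))

        exc⁻ : ∀ e → HasGap σ e → e ℕ.≤ suc d
        exc⁻ e (x , w , gap′ , w≡) with ℕP.<-≤-connex (toℕ i) (toℕ x)
        ... | inj₁ i<x = ℕP.+-cancelˡ-≤ (suc (toℕ i)) e (suc d)
          (ℕP.≤-trans (ℕP.+-monoˡ-≤ e i<x) (ℕP.≤-reflexive (trans (sym w≡) (trans (max gap′) 1+n≡))))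
        -- Row i holds the largest value and, as i < n, is followed by a smaller one, so the rows
        -- from x on do not increase.
        ... | inj₂ x≤i = contradiction
          (increasing gap′ i (fromℕ< (s≤s i<n)) x≤i (ℕP.≤-reflexive (sym (FP.toℕ-fromℕ< (s≤s i<n)))))
          (ℕP.≤⇒≯ (σ≤σi gap _))

      module _ {a} (v≡ : toℕ v ≡ toℕ i + 0) (st : State τ a) where

        i≡n : toℕ i ≡ n
        i≡n = trans (sym (ℕP.+-identityʳ _)) (trans (sym v≡) (max gap))

        -- Offset 0 means that a new largest entry is appended. Old gaps keep their rows and gain
        -- one in offset, and the position past the end is the new gap of offset 0.
        fix⁺ : ∀ e → e ℕ.≤ suc a → HasGap σ e
        fix⁺ zero    _         = gap-at (suc n) (sym (ℕP.+-identityʳ _)) λ r _ n<r _ →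
          contradiction (FP.toℕ<n r) (ℕP.≤⇒≯ n<r)
        fix⁺ (suc e) (s≤s e≤a) with x , w , gap′ , w≡ ← proj₁ (st e) e≤a =
          gap-at (toℕ x) (trans (cong suc (trans (sym (max gap′)) w≡)) (sym (ℕP.+-suc _ e))) inc
          where
          inc : ∀ r s → toℕ x ℕ.≤ toℕ r → r Fin.< s → σ ! r Fin.< σ ! s
          inc r s x≤r r<s with row i r | row i s
          ... | here    | _    = contradiction (subst (ℕ._< toℕ s) i≡n r<s) (ℕP.≤⇒≯ (FP.toℕ≤pred[n] s))
          ... | there j | here = subst₂ Fin._<_ (sym (ins-there i v τ j)) (sym (ins-here i v τ))
            (punchIn-< v (τ ! j) (subst (toℕ (τ ! j) ℕ.<_) (sym (max gap)) (FP.toℕ<n (τ ! j))))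
          ... | there j | there k = ins-mono i v τ (increasing gap′ j k
            (<-punchIn⁻ i j (subst (toℕ x ℕ.≤_) (sym i≡n) (FP.toℕ≤pred[n] x)) x≤r) (punchIn-cancel-< i j k r<s))

        fix⁻ : ∀ e → HasGap σ e → e ℕ.≤ suc a
        fix⁻ zero    _                      = z≤n
        fix⁻ (suc e) (x , w , gap′ , w≡) = s≤s (proj₂ (st e) (gap-at (toℕ x)
          (ℕP.suc-injective (trans (sym (max gap′)) (trans w≡ (ℕP.+-suc _ e))))
          λ j k x≤j j<k → ins-cancel i v τ (increasing gap′ (punchIn i j) (punchIn i k)
            (≤-punchIn i j x≤j) (punchIn-mono-< i j k j<k))))

-- Avoiders of 213.

module Pattern213 where

  -- `top` prevents the new point from being the 2 or the 1 of a 213, `increasing` from being the 3.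
  -- The indices are natural numbers so that the same row and shifted values can be used for
  -- permutations of different sizes.
  record GapAt {n} (τ : Vec (Fin n) n) (i v : ℕ) : Set where
    field
      weakExc    : i ℕ.≤ v
      top        : ∀ r → i ℕ.≤ toℕ r → toℕ (τ ! r) ℕ.< v
      low        : ∀ r → i ℕ.≤ toℕ r → τ ! r Fin.≤ r
      increasing : ∀ r s → r Fin.< s → toℕ s ℕ.< i → toℕ (τ ! r) ℕ.< v → τ ! r Fin.< τ ! s

  open GapAt

  Gap : Vec (Fin n) n → Fin (suc n) → Fin (suc n) → Set
  Gap τ i v = GapAt τ (toℕ i) (toℕ v)

  open Gaps Gap

  insertable : {τ : Vec (Fin n) n} {i v : Fin (suc n)} → Gap τ i v → Insertable τ i v
  insertable gap = record { weakExc = weakExc gap ; top = top gap ; low = low gap }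

  ins-avoids : {τ : Vec (Fin n) n} {i v : Fin (suc n)} → Gap τ i v → Avoids pat213 τ → Avoids pat213 (ins i v τ)
  ins-avoids {τ = τ} {i} {v} gap av (r , s , t , r<s , s<t , rs , rt , st) with row i r | row i s | row i t
  ... | here | _ | _ = ℕP.<-asym (proj₁ rt 2<3) (subst (ins i v τ ! t Fin.<_) (sym (ins-here i v τ))
    (InsertStats.σ-above (insertable gap) t (ℕP.<-trans r<s s<t)))
  ... | there j | here | _ = ℕP.<-asym (proj₁ st 1<3) (subst (ins i v τ ! t Fin.<_) (sym (ins-here i v τ))
    (InsertStats.σ-above (insertable gap) t s<t))
    where
    1<3 : 1 ℕ.< 3
    1<3 = s≤s (s≤s z≤n)
  ... | there j | there k | here = ℕP.<-asym (ins-cancel i v τ (proj₂ rs 1<2))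
    (increasing gap j k (punchIn-cancel-< i j k r<s) (punchIn-below⁻ i k s<t)
      (punchIn-below⁻ v (τ ! j) (subst₂ Fin._<_ (ins-there i v τ j) (ins-here i v τ) (proj₁ rt 2<3))))
  ... | there j | there k | there l = av (pattern213 τ (punchIn-cancel-< i j k r<s) (punchIn-cancel-< i k l s<t)
                                             (ins-cancel i v τ (proj₂ rs 1<2)) (ins-cancel i v τ (proj₁ rt 2<3)))

  gap-del : {τ : Vec (Fin n) n} {i v : Fin (suc n)} → IsPerm (ins i v τ) → Avoids pat213 (ins i v τ) →
            LastWeakExc (ins i v τ) i → Gap τ i v
  gap-del {n} {τ} {i} {v} perm av last = record
    { weakExc    = last-weak last
    ; top        = λ j i≤j → punchIn-below⁻ v (τ ! j)
        (subst₂ Fin._<_ (ins-there i v τ j) (ins-here i v τ) (σ-above (punchIn i j) (<-punchIn i j i≤j)))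
    ; low        = last-low last
    ; increasing = inc
    }
    where
    σ = ins i v τ
    -- Row i + 1 holds a smaller value than row i; a larger value further on would complete a 213.
    σ-above : ∀ r → i Fin.< r → σ ! r Fin.< σ ! i
    σ-above r i<r with s , s≡ , σs<σi ← next-row {σ = σ} perm last (ℕP.<-≤-trans i<r (FP.toℕ≤pred[n] r))
                  with FP.<-cmp s r
    ... | tri≈ _ refl _ = σs<σi
    ... | tri> _ _ r<s  = contradiction (ℕ.s≤s⁻¹ (subst (toℕ r ℕ.<_) s≡ r<s)) (ℕP.<⇒≱ i<r)
    ... | tri< s<r _ _  = ℕP.≰⇒> λ σi≤σr → av (pattern213 σ (ℕP.≤-reflexive (sym s≡)) s<r σs<σi
      (≤∧≢⇒< σ perm (λ i≡r → ℕP.<-irrefl (cong toℕ i≡r) i<r) σi≤σr))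
    inc : ∀ r s → r Fin.< s → s Fin.< i → τ ! r Fin.< v → τ ! r Fin.< τ ! s
    inc r s r<s s<i τr<v = ℕP.≰⇒> λ τs≤τr → av (pattern213 σ (punchIn-mono-< i r s r<s) (punchIn-< i s s<i)
      (ins-mono i v τ (≤∧≢⇒< τ (ins-perm⁻ i v perm) (λ s≡r → ℕP.<-irrefl (cong toℕ (sym s≡r)) r<s) τs≤τr))
      (subst₂ Fin._<_ (sym (ins-there i v τ r)) (sym (ins-here i v τ)) (punchIn-< v (τ ! r) τr<v)))

  gap-at : ∀ {τ : Vec (Fin n) n} {x w e} → w ℕ.≤ n → w ≡ x + e → GapAt τ x w →
           HasGap τ e
  gap-at {n} {τ} {x} {w} {e} w≤n w≡ gap = fromℕ< x<1+n , fromℕ< w<1+n ,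
    subst₂ (GapAt τ) (sym x≡) (sym w≡′) gap , trans w≡′ (trans w≡ (cong (_+ e) (sym x≡)))
    where
    w<1+n : w ℕ.< suc n
    w<1+n = s≤s w≤n
    x<1+n : x ℕ.< suc n
    x<1+n = s≤s (ℕP.≤-trans (weakExc gap) w≤n)
    x≡ = FP.toℕ-fromℕ< x<1+n
    w≡′ = FP.toℕ-fromℕ< w<1+n

  -- The value v sits in a row before i, and row i has a smaller value, so these two rows
  -- form a descent in front of i′ below v′.
  gaps-not-nested : {τ : Vec (Fin n) n} → IsPerm τ → ∀ {i v i′ v′} → GapAt τ i v → GapAt τ i′ v′ →
                    i′ ℕ.≤ n → v′ ℕ.≤ n → i ℕ.< i′ → ¬ v ℕ.< v′
  gaps-not-nested {n} {τ} perm {i} {v} {i′} {v′} gap gap′ i′≤n v′≤n i<i′ v<v′ =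
    ℕP.<-asym (subst (ℕ._< toℕ (τ ! s)) τr≡v (increasing gap′ r s r<s s<i′ τr<v′))
              (top gap s (ℕP.≤-reflexive (sym s≡i)))
    where
    r = proj₁ (value τ perm (ℕP.<-≤-trans v<v′ v′≤n))
    τr≡v = proj₂ (value τ perm (ℕP.<-≤-trans v<v′ v′≤n))
    s = fromℕ< (ℕP.<-≤-trans i<i′ i′≤n)
    s≡i = FP.toℕ-fromℕ< (ℕP.<-≤-trans i<i′ i′≤n)
    r<s : r Fin.< s
    r<s = ℕP.≰⇒> λ s≤r → ℕP.<-irrefl τr≡v (top gap r (subst (ℕ._≤ toℕ r) s≡i s≤r))
    s<i′ : toℕ s ℕ.< i′
    s<i′ = subst (ℕ._< i′) (sym s≡i) i<i′
    τr<v′ : toℕ (τ ! r) ℕ.< v′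
    τr<v′ = subst (ℕ._< v′) (sym τr≡v) v<v′

  -- Of two gaps, the one with the larger row has no larger value by `gaps-not-nested`, hence a
  -- strictly smaller offset.
  gap-unique : {τ : Vec (Fin n) n} {i v i′ v′ : Fin (suc n)} {e : ℕ} → IsPerm τ → Gap τ i v → Gap τ i′ v′ →
               toℕ v ≡ toℕ i + e → toℕ v′ ≡ toℕ i′ + e → i ≡ i′
  gap-unique {i = i} {v} {i′} {v′} {e} perm gap gap′ v≡ v′≡ with FP.<-cmp i i′
  ... | tri≈ _ i≡i′ _ = i≡i′
  ... | tri< i<i′ _ _ = contradiction (subst₂ ℕ._<_ (sym v≡) (sym v′≡) (ℕP.+-monoˡ-< e i<i′))
    (gaps-not-nested perm gap gap′ (FP.toℕ≤pred[n] i′) (FP.toℕ≤pred[n] v′) i<i′)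
  ... | tri> _ _ i′<i = contradiction (subst₂ ℕ._<_ (sym v′≡) (sym v≡) (ℕP.+-monoˡ-< e i′<i))
    (gaps-not-nested perm gap′ gap (FP.toℕ≤pred[n] i) (FP.toℕ≤pred[n] v) i′<i)

  module Inserted {n} {τ : Vec (Fin n) n} {i v : Fin (suc n)}
                  (perm : IsPerm τ) (avoids : Avoids pat213 τ) (gap : Gap τ i v) where

    private
      σ = ins i v τ
      σ-perm = ins-perm {τ = τ} i v perm
      σ-avoids = ins-avoids gap avoids
      open InsertStats (insertable gap) using (σ-above; σ-below-diagonal)

    σi≡v : toℕ (σ ! i) ≡ toℕ v
    σi≡v = cong toℕ (ins-here i v τ)

    increasing-before : ∀ t r s → r Fin.< s → s Fin.< t → σ ! r Fin.≤ σ ! t → σ ! r Fin.< σ ! s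
    increasing-before t r s r<s s<t σr≤σt = ℕP.≰⇒> λ σs≤σr → σ-avoids (pattern213 σ r<s s<t
      (≤∧≢⇒< σ σ-perm (λ s≡r → ℕP.<-irrefl (cong toℕ (sym s≡r)) r<s) σs≤σr)
      (≤∧≢⇒< σ σ-perm (λ r≡t → ℕP.<-irrefl (cong toℕ r≡t) (ℕP.<-trans r<s s<t)) σr≤σt))

    -- In front of the new gap only values up to v matter, and there σ i itself, as a potential 3,
    -- already forbids descents.
    gap-after : ∀ {w} → toℕ i ℕ.< w → w ℕ.≤ suc (toℕ v) → (∀ r → i Fin.< r → toℕ (σ ! r) ℕ.< w) →
                GapAt σ (suc (toℕ i)) w
    gap-after {w} i<w w≤1+v above = record
      { weakExc    = i<w
      ; top        = above
      ; low        = λ r → ℕP.<⇒≤ ∘ σ-below-diagonal r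
      ; increasing = inc
      }
      where
      inc : ∀ r s → r Fin.< s → toℕ s ℕ.< suc (toℕ i) → toℕ (σ ! r) ℕ.< w → σ ! r Fin.< σ ! s
      inc r s r<s (s≤s s≤i) σr<w with ℕP.m≤n⇒m<n∨m≡n s≤i
      ... | inj₁ s<i = increasing-before i r s r<s s<i σr≤σi
        where
        σr≤σi : σ ! r Fin.≤ σ ! i
        σr≤σi = subst (toℕ (σ ! r) ℕ.≤_) (sym σi≡v) (ℕ.s≤s⁻¹ (ℕP.<-≤-trans σr<w w≤1+v))
      ... | inj₂ s≡i with refl ← FP.toℕ-injective s≡i =
        ≤∧≢⇒< σ σ-perm (λ r≡s → ℕP.<-irrefl (cong toℕ r≡s) r<s)
          (subst (toℕ (σ ! r) ℕ.≤_) (sym σi≡v) (ℕ.s≤s⁻¹ (ℕP.<-≤-trans σr<w w≤1+v)))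

    v≤n : toℕ v ℕ.≤ n
    v≤n = FP.toℕ≤pred[n] v

    module _ {d} (v≡ : toℕ v ≡ toℕ i + suc d) where

      i<v : i Fin.< v
      i<v = subst (toℕ i ℕ.<_) (sym v≡) (ℕP.m<m+n (toℕ i) (s≤s z≤n))

      -- If all values behind i are less than i + 1 + e, the point (i + 1, i + 1 + e) is a gap.
      -- Otherwise let σ t be the largest of them and take the value σ t + 1 in the row that gives
      -- offset e. This row lies behind i and at most at t, so σ t acts as the 3 that forbids
      -- descents before it.
      exc⁺ : ∀ e → e ℕ.≤ suc d → HasGap σ e
      exc⁺ e e≤ with FP.any? (λ r → i Fin.<? r ×-dec suc (toℕ i) + e ℕ.≤? toℕ (σ ! r))
      ... | no none = gap-at (ℕP.≤-trans w≤1+v (s≤s v≤n)) refl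
        (gap-after (s≤s (ℕP.m≤m+n _ e)) w≤1+v λ r i<r → ℕP.≰⇒> λ le → none (r , i<r , le))
        where
        w≤1+v : suc (toℕ i) + e ℕ.≤ suc (toℕ v)
        w≤1+v = s≤s (subst (toℕ i + e ℕ.≤_) (sym v≡) (ℕP.+-monoʳ-≤ (toℕ i) e≤))
      ... | yes (r , i<r , high)
        with y , (t , i<t , refl) , max ← largest
               {P = λ y → ∃ λ t → i Fin.< t × σ ! t ≡ y}
               (λ y → FP.any? λ t → i Fin.<? t ×-dec σ ! t FP.≟ y) (σ ! r , r , i<r , refl)
        = gap-at (FP.toℕ<n (σ ! t)) (sym (ℕP.m∸n+n≡m e≤w)) record
          { weakExc    = ℕP.m∸n≤m w e
          ; top        = λ s x≤s → s≤s (ℕP.≮⇒≥ λ σt<σs → max (σ ! s) σt<σs (s , ℕP.<-≤-trans i<x x≤s , refl))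
          ; low        = λ s x≤s → ℕP.<⇒≤ (σ-below-diagonal s (ℕP.<-≤-trans i<x x≤s))
          ; increasing = λ r s r<s s<x σr<w → increasing-before t r s r<s (ℕP.<-≤-trans s<x x≤t) (ℕ.s≤s⁻¹ σr<w)
          }
        where
        w = suc (toℕ (σ ! t))
        high′ : suc (toℕ i) + e ℕ.≤ w
        high′ = ℕP.m≤n⇒m≤1+n (ℕP.≤-trans high (ℕP.≮⇒≥ λ σt<σr → max (σ ! r) σt<σr (r , i<r , refl)))
        e≤w : e ℕ.≤ w
        e≤w = ℕP.m+n≤o⇒n≤o (suc (toℕ i)) high′
        i<x : toℕ i ℕ.< w ∸ e
        i<x = ℕP.m+n≤o⇒m≤o∸n (suc (toℕ i)) high′
        x≤t : w ∸ e ℕ.≤ toℕ t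
        x≤t = ℕP.≤-trans (ℕP.m∸n≤m w e) (σ-below-diagonal t i<t)

      -- A gap (x, w) has x > i because row i is a strict excedance. It has w ≤ v + 1, since
      -- otherwise the value v + 1, which must lie before i, would form with σ i = v a descent that
      -- the gap forbids.
      exc⁻ : ∀ e → HasGap σ e → e ℕ.≤ suc d
      exc⁻ e (x , w , gap′ , w≡) = ℕP.+-cancelˡ-≤ (suc (toℕ i)) e (suc d)
        (ℕP.≤-trans (ℕP.+-monoˡ-≤ e i<x) (subst₂ ℕ._≤_ w≡ (cong suc v≡) (ℕP.≮⇒≥ w≯1+v)))
        where
        i<x : i Fin.< x
        i<x = ℕP.≰⇒> λ x≤i → ℕP.<⇒≱ i<v (subst (ℕ._≤ toℕ i) σi≡v (low gap′ i x≤i))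
        w≯1+v : ¬ suc (toℕ v) ℕ.< toℕ w
        w≯1+v 1+v<w with r , σr≡ ← value σ σ-perm (ℕP.<-≤-trans 1+v<w (FP.toℕ≤pred[n] w)) with FP.<-cmp r i
        ... | tri< r<i _ _ = ℕP.<-asym (ℕP.≤-reflexive (sym σr≡))
          (subst (toℕ (σ ! r) ℕ.<_) σi≡v (increasing gap′ r i r<i i<x (subst (ℕ._< toℕ w) (sym σr≡) 1+v<w)))
        ... | tri≈ _ refl _ = ℕP.1+n≢n (trans (sym σr≡) σi≡v)
        ... | tri> _ _ i<r = ℕP.<-asym (ℕP.≤-reflexive (sym σr≡)) (σ-above r i<r)

    module _ {a} (v≡ : toℕ v ≡ toℕ i + 0) (st : State τ a) where

      v≡i : toℕ v ≡ toℕ i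
      v≡i = trans v≡ (ℕP.+-identityʳ _)

      module _ {x w : ℕ} (x≤i : x ℕ.≤ toℕ i) (i≤w : toℕ i ℕ.≤ w) where

        v≤w : toℕ v ℕ.≤ w
        v≤w = subst (ℕ._≤ w) (sym v≡i) i≤w

        -- As v = i, rows and values are renumbered by the same monotone map, so comparisons with
        -- the diagonal do not change.
        τ-low : ∀ j → σ ! punchIn i j Fin.≤ punchIn i j → τ ! j Fin.≤ j
        τ-low j le = FP.punchIn-cancel-≤ i (τ ! j) j (subst (Fin._≤ punchIn i j)
          (trans (ins-there i v τ j) (cong (λ v → punchIn v (τ ! j)) (FP.toℕ-injective v≡i))) le)

        σ-low : ∀ j → τ ! j Fin.≤ j → σ ! punchIn i j Fin.≤ punchIn i j
        σ-low j le = subst (Fin._≤ punchIn i j)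
          (sym (trans (ins-there i v τ j) (cong (λ v → punchIn v (τ ! j)) (FP.toℕ-injective v≡i))))
          (FP.punchIn-mono-≤ i (τ ! j) j le)

        τ-< : ∀ j → toℕ (σ ! punchIn i j) ℕ.< suc w → toℕ (τ ! j) ℕ.< w
        τ-< j = punchIn-<⁻ v (τ ! j) v≤w ∘ subst (λ y → toℕ y ℕ.< suc w) (ins-there i v τ j)

        σ-< : ∀ j → toℕ (τ ! j) ℕ.< w → toℕ (σ ! punchIn i j) ℕ.< suc w
        σ-< j = subst (λ y → toℕ y ℕ.< suc w) (sym (ins-there i v τ j)) ∘ punchIn-<-suc v (τ ! j)

        lift-gap : GapAt τ x w → GapAt σ x (suc w)
        lift-gap g = record
          { weakExc    = ℕP.m≤n⇒m≤1+n (weakExc g)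
          ; top        = top′
          ; low        = low′
          ; increasing = inc
          }
          where
          top′ : ∀ r → x ℕ.≤ toℕ r → toℕ (σ ! r) ℕ.< suc w
          top′ r x≤r with row i r
          ... | here    = s≤s (subst (ℕ._≤ w) (sym σi≡v) v≤w)
          ... | there j = σ-< j (top g j (<-punchIn⁻ i j x≤i x≤r))
          low′ : ∀ r → x ℕ.≤ toℕ r → σ ! r Fin.≤ r
          low′ r x≤r with row i r
          ... | here    = ℕP.≤-reflexive (trans σi≡v v≡i)
          ... | there j = σ-low j (low g j (<-punchIn⁻ i j x≤i x≤r))
          inc : ∀ r s → r Fin.< s → toℕ s ℕ.< x → toℕ (σ ! r) ℕ.< suc w → σ ! r Fin.< σ ! s
          inc r s r<s s<x σr<w with row i r | row i s
          ... | here    | _       = contradiction (ℕP.<-trans r<s s<x) (ℕP.≤⇒≯ x≤i)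
          ... | there j | here    = contradiction s<x (ℕP.≤⇒≯ x≤i)
          ... | there j | there k = ins-mono i v τ (increasing g j k (punchIn-cancel-< i j k r<s)
            (ℕP.≤-<-trans (≤-punchIn i k ℕP.≤-refl) s<x) (τ-< j σr<w))

        lower-gap : GapAt σ x (suc w) → GapAt τ x w
        lower-gap g = record
          { weakExc    = ℕP.≤-trans x≤i i≤w
          ; top        = λ j x≤j → τ-< j (top g (punchIn i j) (≤-punchIn i j x≤j))
          ; low        = λ j x≤j → τ-low j (low g (punchIn i j) (≤-punchIn i j x≤j))
          ; increasing = λ j k j<k k<x τj<w → ins-cancel i v τ
              (increasing g (punchIn i j) (punchIn i k) (punchIn-mono-< i j k j<k)
                (ℕP.≤-<-trans (ℕP.≤-reflexive (punchIn-below i k (ℕP.<-≤-trans k<x x≤i))) k<x) (σ-< j τj<w))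
          }

      -- The point (i, i) is itself a gap of τ, and gaps are weak excedances: i < x or w < i would
      -- put one gap strictly below the other in both coordinates.
      straddle : ∀ {x w : Fin (suc n)} → Gap τ x w → x Fin.≤ i × i Fin.≤ w
      straddle {x} {w} g =
        ℕP.≮⇒≥ (λ i<x → gaps-not-nested perm gap g (FP.toℕ≤pred[n] x) (FP.toℕ≤pred[n] w) i<x
                          (ℕP.<-≤-trans (subst (ℕ._< toℕ x) (sym v≡i) i<x) (weakExc g))) ,
        ℕP.≮⇒≥ (λ w<i → gaps-not-nested perm g gap (FP.toℕ≤pred[n] i) v≤n
                          (ℕP.≤-<-trans (weakExc g) w<i) (subst (toℕ w ℕ.<_) (sym v≡i) w<i))

      -- The cell (i + 1, i + 1) behind the fixed point is the new gap of offset 0. An old gap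
      -- straddles the fixed point, so its row stays and its value grows by one.
      fix⁺ : ∀ e → e ℕ.≤ suc a → HasGap σ e
      fix⁺ zero    _         = gap-at (s≤s v≤n) (cong suc v≡)
        (gap-after (s≤s (weakExc gap)) ℕP.≤-refl λ r i<r → ℕP.m≤n⇒m≤1+n (σ-above r i<r))
      fix⁺ (suc e) (s≤s e≤a) =
        let x , w , g , w≡ = proj₁ (st e) e≤a
            x≤i , i≤w = straddle g
        in gap-at (s≤s (FP.toℕ≤pred[n] w)) (trans (cong suc w≡) (sym (ℕP.+-suc _ e))) (lift-gap x≤i i≤w g)

      fix⁻ : ∀ e → HasGap σ e → e ℕ.≤ suc a
      fix⁻ zero    _                                 = z≤n
      fix⁻ (suc e) (x , suc w , g , w≡) = s≤s (proj₂ (st e)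
        (gap-at (FP.toℕ≤pred[n] w) (ℕP.suc-injective (trans w≡ (ℕP.+-suc _ e))) (lower-gap x≤i i≤w g)))
        where
        x<1+w : toℕ x ℕ.< suc (toℕ w)
        x<1+w = subst (toℕ x ℕ.<_) (sym w≡) (ℕP.m<m+n (toℕ x) (s≤s z≤n))
        x≤i : x Fin.≤ i
        x≤i = ℕP.≮⇒≥ λ i<x → contradicts i<x
          where
          -- The value i + 1 would sit in a row before i, although σ i = i
          contradicts : ¬ i Fin.< x
          contradicts i<x
            with r , σr≡ ← value σ σ-perm {suc (toℕ i)} (s≤s (ℕP.<-≤-trans i<x (ℕP.≤-trans (ℕ.s≤s⁻¹ x<1+w) (FP.toℕ≤pred[n] w))))
            with FP.<-cmp r i
          ... | tri< r<i _ _ = ℕP.<-asym (ℕP.≤-reflexive (sym σr≡)) (subst (toℕ (σ ! r) ℕ.<_) (trans σi≡v v≡i)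
            (increasing g r i r<i i<x (subst (ℕ._< suc (toℕ w)) (sym σr≡) (ℕP.≤-<-trans i<x x<1+w))))
          ... | tri≈ _ refl _ = ℕP.1+n≢n (trans (sym σr≡) (trans σi≡v v≡i))
          ... | tri> _ _ i<r = ℕP.<-asym (ℕP.≤-reflexive (sym σr≡)) (subst (toℕ (σ ! r) ℕ.<_) v≡i (σ-above r i<r))
        i≤w : toℕ i ℕ.≤ toℕ w
        i≤w = ℕ.s≤s⁻¹ (subst (ℕ._< suc (toℕ w)) (trans σi≡v v≡i) (top g i x≤i))
      fix⁻ (suc e) (x , zero , g , w≡) = contradiction (trans w≡ (ℕP.+-suc _ e)) λ ()

  scheme : Scheme pat213
  scheme = record
    { Gap        = Gap
    ; insertable = insertable
    ; ins-avoids = ins-avoids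
    ; gap-del    = gap-del
    ; gap-[]     = record { weakExc = z≤n ; top = λ () ; low = λ () ; increasing = λ () }
    ; gap-unique = gap-unique
    ; state-exc  = λ perm av gap v≡ e → Inserted.exc⁺ perm av gap v≡ e , Inserted.exc⁻ perm av gap v≡ e
    ; state-fix  = λ perm av gap v≡ st e → Inserted.fix⁺ perm av gap v≡ st e , Inserted.fix⁻ perm av gap v≡ st e
    }

-- The pattern 132

opposite-≤ : {i j : Fin n} → i Fin.≤ j → opposite j Fin.≤ opposite i
opposite-≤ {n} {i} {j} i≤j = subst₂ ℕ._≤_ (sym (FP.opposite-prop j)) (sym (FP.opposite-prop i))
  (ℕP.∸-monoʳ-≤ n (s≤s i≤j))

opposite-≤⁻ : {i j : Fin n} → opposite j Fin.≤ opposite i → i Fin.≤ j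
opposite-≤⁻ {i = i} {j} = subst₂ Fin._≤_ (FP.opposite-involutive i) (FP.opposite-involutive j) ∘ opposite-≤

opposite-< : {i j : Fin n} → i Fin.< j → opposite j Fin.< opposite i
opposite-< i<j = ℕP.≰⇒> (ℕP.<⇒≱ i<j ∘ opposite-≤⁻)

opposite-<⁻ : {i j : Fin n} → opposite j Fin.< opposite i → i Fin.< j
opposite-<⁻ lt = ℕP.≰⇒> (ℕP.<⇒≱ lt ∘ opposite-≤)

-- ρ is the reflection of σ in the antidiagonal, i.e. its reverse-complement-inverse.
record Mirror {n} (σ ρ : Vec (Fin n) n) : Set where
  constructor reflecting
  field reflect : ∀ k → ρ ! opposite (σ ! k) ≡ opposite k
open Mirror

pattern132 : (σ : Vec (Fin n) n) {i j k : Fin n} → i Fin.< j → j Fin.< k →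
             σ ! i Fin.< σ ! k → σ ! k Fin.< σ ! j → Contains pat132 σ
pattern132 σ i<j j<k σi<σk σk<σj = _ , _ , _ , i<j , j<k ,
  ((λ _ → ℕP.<-trans σi<σk σk<σj) , λ { (s≤s ()) }) ,
  ((λ _ → σi<σk) , λ { (s≤s ()) }) ,
  ((λ { (s≤s (s≤s ())) }) , λ _ → σk<σj)

mirror : {σ : Vec (Fin n) n} → IsPerm σ → ∃ (Mirror σ)
mirror {σ = σ} perm = Vec.tabulate (λ i → opposite (π⁻¹ (opposite i))) , reflecting λ k →
  trans (VecP.lookup∘tabulate _ (opposite (σ ! k)))
        (cong opposite (perm _ _ (trans (proj₂ (preimage {σ = σ} perm _)) (FP.opposite-involutive (σ ! k)))))
  where
  π⁻¹ : Fin _ → Fin _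
  π⁻¹ y = proj₁ (preimage {σ = σ} perm y)

module _ {σ ρ : Vec (Fin n) n} (perm : IsPerm σ) (mir : Mirror σ ρ) where

  private
    m = reflect mir

  private
    m⁻ : ∀ i → σ ! opposite (ρ ! i) ≡ opposite i
    m⁻ i with k , σk≡ ← preimage {σ = σ} perm (opposite i) = begin
      σ ! opposite (ρ ! i)                       ≡⟨ cong (λ j → σ ! opposite (ρ ! j)) i≡ ⟩
      σ ! opposite (ρ ! opposite (σ ! k))        ≡⟨ cong (λ j → σ ! opposite j) (m k) ⟩
      σ ! opposite (opposite k)                  ≡⟨ cong (σ !_) (FP.opposite-involutive k) ⟩
      σ ! k                                      ≡⟨ σk≡ ⟩
      opposite i                                 ∎
      where
      open ≡-Reasoning
      i≡ : i ≡ opposite (σ ! k)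
      i≡ = trans (sym (FP.opposite-involutive i)) (cong opposite (sym σk≡))

  mirror-sym : Mirror ρ σ
  mirror-sym = reflecting m⁻

  mirror-perm : IsPerm ρ
  mirror-perm i j eq = trans (sym (FP.opposite-involutive i))
    (trans (cong opposite (trans (sym (m⁻ i)) (trans (cong (λ y → σ ! opposite y) eq) (m⁻ j))))
           (FP.opposite-involutive j))

  mirror-functional : ∀ {ρ′} → Mirror σ ρ′ → ρ ≡ ρ′
  mirror-functional {ρ′} m′ = lookup-injective agree
    where
    agree : ∀ i → ρ ! i ≡ ρ′ ! i
    agree i with k , σk≡ ← preimage {σ = σ} perm (opposite i)
      with refl ← trans (sym (FP.opposite-involutive i)) (cong opposite (sym σk≡)) = trans (m k) (sym (reflect m′ k))

  -- Reflection exchanges rows and values and reverses both orders: the rows of a 132 in ρ become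
  -- the values of a 213 in σ, with the second, third and first point in this order as 2, 1 and 3.
  mirror-avoids132 : Avoids pat213 σ → Avoids pat132 ρ
  mirror-avoids132 av (i , j , k , i<j , j<k , ij , ik , jk) = av (pattern213 σ
    (opposite-< (proj₂ jk 2<3)) (opposite-< (proj₁ ik 1<2))
    (subst₂ Fin._<_ (sym (m⁻ k)) (sym (m⁻ j)) (opposite-< j<k))
    (subst₂ Fin._<_ (sym (m⁻ j)) (sym (m⁻ i)) (opposite-< i<j)))

  mirror-avoids213 : Avoids pat132 ρ → Avoids pat213 σ
  mirror-avoids213 av (i , j , k , i<j , j<k , ij , ik , jk) = av (pattern132 ρ
    (opposite-< (proj₁ ik 2<3)) (opposite-< (proj₂ ij 1<2))
    (subst₂ Fin._<_ (sym (m k)) (sym (m j)) (opposite-< j<k))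
    (subst₂ Fin._<_ (sym (m j)) (sym (m i)) (opposite-< i<j)))

  private
    π : Perm.Permutation n n
    π = toPermutation {σ = σ} perm Perm.∘ₚ Perm.reverse

  mirror-exc : exc ρ ≡ exc σ
  mirror-exc = begin
    exc ρ                                                  ≡⟨ exc≡sum ρ ⟩
    sum (λ i → ind (i Fin.<? ρ ! i))                       ≡⟨ sum-permute (λ i → ind (i Fin.<? ρ ! i)) π ⟩
    sum (λ k → ind (opposite (σ ! k) Fin.<? ρ ! opposite (σ ! k)))
      ≡⟨ sum-ind-⇔ (λ k → opposite (σ ! k) Fin.<? ρ ! opposite (σ ! k)) (λ k → k Fin.<? σ ! k)
                   (λ k → opposite-<⁻ ∘ subst (opposite (σ ! k) Fin.<_) (m k))
                   (λ k → subst (opposite (σ ! k) Fin.<_) (sym (m k)) ∘ opposite-<) ⟩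
    sum (λ k → ind (k Fin.<? σ ! k))                       ≡⟨ exc≡sum σ ⟨
    exc σ                                                  ∎
    where open ≡-Reasoning

  -- The chain of inequalities is read backwards: upper crossings stay upper, lower ones stay lower,
  -- and the two arcs change places. The final exchange of sums in `mirror-crs` accounts for this
  -- swap.
  mirror-crossing : ∀ k l → Crossing ρ (opposite (σ ! k) , opposite (σ ! l)) → Crossing σ (l , k)
  mirror-crossing k l crossing rewrite m k | m l with crossing
  ... | inj₁ (a , b , c) = inj₁ (opposite-<⁻ c , opposite-<⁻ b , opposite-<⁻ a)
  ... | inj₂ (a , b , c) = inj₂ (opposite-<⁻ c , opposite-≤⁻ b , opposite-<⁻ a)

  mirror-crossing⁻ : ∀ k l → Crossing σ (l , k) → Crossing ρ (opposite (σ ! k) , opposite (σ ! l))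
  mirror-crossing⁻ k l crossing rewrite m k | m l with crossing
  ... | inj₁ (a , b , c) = inj₁ (opposite-< c , opposite-< b , opposite-< a)
  ... | inj₂ (a , b , c) = inj₂ (opposite-< c , opposite-≤ b , opposite-< a)

  mirror-crs : crs ρ ≡ crs σ
  mirror-crs = begin
    crs ρ
      ≡⟨ crs≡sum ρ ⟩
    sum (λ i → sum (λ j → ind (crossing? ρ (i , j))))
      ≡⟨ sum-permute (λ i → sum (λ j → ind (crossing? ρ (i , j)))) π ⟩
    sum (λ k → sum (λ j → ind (crossing? ρ (opposite (σ ! k) , j))))
      ≡⟨ sum-cong-≗ (λ k → sum-permute (λ j → ind (crossing? ρ (opposite (σ ! k) , j))) π) ⟩
    sum (λ k → sum (λ l → ind (crossing? ρ (opposite (σ ! k) , opposite (σ ! l)))))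
      ≡⟨ sum-cong-≗ (λ k → sum-ind-⇔ (λ l → crossing? ρ (opposite (σ ! k) , opposite (σ ! l)))
                                       (λ l → crossing? σ (l , k)) (mirror-crossing k) (mirror-crossing⁻ k)) ⟩
    sum (λ k → sum (λ l → ind (crossing? σ (l , k))))
      ≡⟨ ∑-comm (λ k l → ind (crossing? σ (l , k))) ⟩
    sum (λ l → sum (λ k → ind (crossing? σ (l , k))))
      ≡⟨ crs≡sum σ ⟨
    crs σ ∎
    where open ≡-Reasoning

open Enumeration Pattern213.scheme
open Node

mirrored : Node n → Vec (Fin n) n
mirrored x = proj₁ (mirror {σ = word x} (perm x))

isMirrored : (x : Node n) → Mirror (word x) (mirrored x)
isMirrored x = proj₂ (mirror {σ = word x} (perm x))

mirrored-injective : (x y : Node n) → mirrored x ≡ mirrored y → word x ≡ word y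
mirrored-injective x y eq = mirror-functional {ρ = word x}
  (mirror-perm {ρ = mirrored x} (perm x) (isMirrored x)) (mirror-sym (perm x) (isMirrored x))
  (subst (λ ρ → Mirror ρ (word y)) (sym eq) (mirror-sym (perm y) (isMirrored y)))

mirrored↭avoiders : ∀ n → map mirrored (level n) ↭ avoiders n pat132
mirrored↭avoiders n = unique-↭
  (AllPairsP.map⁺ (AllPairs.map (λ {x} {y} x≢y → x≢y ∘ mirrored-injective x y) (level-distinct n)))
  (avoiders-unique pat132 n) sound complete
  where
  sound : ∀ {ρ} → ρ ∈ map mirrored (level n) → ρ ∈ avoiders n pat132
  sound ρ∈ with x , _ , refl ← ∈-map⁻ mirrored ρ∈ =
    ∈-avoiders⁺ pat132 (mirror-perm (perm x) (isMirrored x)) (mirror-avoids132 (perm x) (isMirrored x) (avoids x))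
  complete : ∀ {ρ} → ρ ∈ avoiders n pat132 → ρ ∈ map mirrored (level n)
  complete {ρ} ρ∈ with pm , av ← ∈-avoiders⁻ pat132 ρ∈
    -- Being symmetric, the relation `Mirror` takes ρ back to a 213-avoider, whose node has ρ as its
    -- only reflection.
    with σ , m ← mirror {σ = ρ} pm
    with x , x∈ , refl ← level-complete (mirror-perm pm m) (mirror-avoids213 (mirror-perm pm m) (mirror-sym pm m) av)
    = subst (_∈ map mirrored (level n)) (mirror-functional (perm x) (isMirrored x) (mirror-sym pm m)) (∈-map⁺ mirrored x∈)

theorem5p2 : ∀ {c ℓ} (R : CommutativeSemiring c ℓ) (n : ℕ) (τ : Vec ℕ 3) →
    τ ≡ pat213 ⊎ τ ≡ pat132 ⊎ τ ≡ pat321 →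
    (q p : CommutativeSemiring.Carrier R) →
    CommutativeSemiring._≈_ R (excCrsGF R n τ q p) (qpCatalan R n q p)
theorem5p2 R n _ (inj₁ refl) q p =
  GF.gf≈catalan R q p Pattern213.scheme pat213 word (λ _ → refl , refl) level↭avoiders n
theorem5p2 R n _ (inj₂ (inj₁ refl)) q p =
  GF.gf≈catalan R q p Pattern213.scheme pat132 mirrored
    (λ x → mirror-exc (perm x) (isMirrored x) , mirror-crs (perm x) (isMirrored x)) mirrored↭avoiders n
theorem5p2 R n _ (inj₂ (inj₂ refl)) q p =
  GF.gf≈catalan R q p Pattern321.scheme pat321 E321.Node.word (λ _ → refl , refl) E321.level↭avoiders n
  where module E321 = Enumeration Pattern321.scheme
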